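{- Let $G$ be a (finite, simple) plane graph with minimum degree five having no vertices of degree $7$, $8$ or $9$. Then $G$ contains at least one of the following minor $5$-stars: a $\langle 5,6,6,5,\infty\rangle$-star, a $\langle 5,6,6,6,17\rangle$-star, a $\langle 6,6,6,6,11\rangle$-star, a $\langle 5,5,10,5,12\rangle$-star.
   Context: A plane graph is a graph embedded in the plane without edge crossings; $\deg(v)$ denotes the degree of $v$ in $G$. For integers (or $\infty$) $\kappa_1,\dots,\kappa_5$, a $\langle \kappa_1,\kappa_2,\kappa_3,\kappa_4,\kappa_5\rangle$-star in $G$ is a vertex $v$ of degree exactly $5$ together with its five neighbors $v_1,\dots,v_5$, listed in the cyclic order around $v$ given by the embedding (starting at some neighbor, in either orientation), such that $\deg(v_i)\le \kappa_i$ for $i=1,\dots,5$; the entry $\infty$ means no restriction. A minor $5$-star is a $5$-vertex together with its five neighbors. -}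

module Defs where

open import Data.Nat using (ℕ; zero; suc; _+_; _*_; _≤_; _≤ᵇ_)
open import Data.Fin using (Fin; toℕ; _≟_)
open import Data.Bool using (Bool; true; false; T; _∧_; _∨_; not; if_then_else_)
open import Data.Bool.ListAction using (all; any)
open import Data.List using (List; []; _∷_; length; filterᵇ; allFin; upTo; reverse; take; drop; _++_; concatMap; map)
open import Data.List.Relation.Binary.Permutation.Propositional using (_↭_)
open import Data.Vec using (Vec; lookup; toList)
open import Data.Maybe using (Maybe; just; nothing)
open import Data.Product using (_×_; _,_; Σ; ∃; proj₁; proj₂)
open import Data.Sum using (_⊎_)
open import Relation.Binary.PropositionalEquality using (_≡_)
open import Relation.Nullary.Decidable using (⌊_⌋)
open import Data.Unit using (⊤)

_==_ : ∀ {n} → Fin n → Fin n → Bool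
u == v = ⌊ u ≟ v ⌋

nbrs : ∀ {n} → (Fin n → Fin n → Bool) → Fin n → List (Fin n)
nbrs {n} adj v = filterᵇ (adj v) (allFin n)

nextIn : ∀ {n} → Fin n → List (Fin n) → Fin n → Fin n
nextIn f [] u = u
nextIn f (x ∷ []) u = f
nextIn f (x ∷ y ∷ xs) u = if x == u then y else nextIn f (y ∷ xs) u

cycSucc : ∀ {n} → List (Fin n) → Fin n → Fin n
cycSucc [] u = u
cycSucc (x ∷ xs) u = nextIn x (x ∷ xs) u

-- Plane graphs, as combinatorial embeddings (rotation systems) of genus 0.
-- rot v lists the neighbours of v in the clockwise cyclic order of the
-- embedding. Faces are the orbits of the face-tracing map on darts
-- (u , v) ↦ (v , cycSucc (rot v) u); every isolated vertex contributes one
-- additional face. The embedding is plane (every component embedded in the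
-- sphere) iff Euler's formula V - E + F = 2C holds, i.e.
-- 2V + 2F = 2E + 4C = (#darts) + 4C   (Heffter–Edmonds–Ringel).

Dart : ℕ → Set
Dart n = Fin n × Fin n

module Embedding {n : ℕ} (adj : Fin n → Fin n → Bool)
                 (rot : Fin n → List (Fin n)) where

  darts : List (Dart n)
  darts = concatMap (λ u → map (λ v → (u , v)) (nbrs adj u)) (allFin n)

  faceStep : Dart n → Dart n
  faceStep (u , v) = (v , cycSucc (rot v) u)

  iter : ℕ → Dart n → Dart n
  iter zero d = d
  iter (suc k) d = faceStep (iter k d)

  code : Dart n → ℕ
  code (u , v) = toℕ u * n + toℕ v

  -- d is the representative (minimal code) of its face orbit
  -- (orbits have length at most n * n).
  faceRep : Dart n → Bool
  faceRep d = all (λ k → code d ≤ᵇ code (iter k d)) (upTo (n * n))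

  isolated : Fin n → Bool
  isolated v = not (any (adj v) (allFin n))

  numFaces : ℕ
  numFaces = length (filterᵇ faceRep darts) + length (filterᵇ isolated (allFin n))

  reach : Fin n → ℕ → Fin n → Bool
  reach u zero w = u == w
  reach u (suc k) w = reach u k w ∨ any (λ x → reach u k x ∧ adj x w) (allFin n)

  compRep : Fin n → Bool
  compRep v = all (λ w → not (reach v n w) ∨ (toℕ v ≤ᵇ toℕ w)) (allFin n)

  numComponents : ℕ
  numComponents = length (filterᵇ compRep (allFin n))

record PlaneGraph (n : ℕ) : Set where
  field
    adj    : Fin n → Fin n → Bool
    sym    : ∀ u v → adj u v ≡ adj v u
    irrefl : ∀ v → adj v v ≡ false
    rot    : Fin n → List (Fin n)
    rotNbrs : ∀ v → rot v ↭ nbrs adj v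
    euler  : let open Embedding adj rot in
             2 * n + 2 * numFaces ≡ length darts + 4 * numComponents

  deg : Fin n → ℕ
  deg v = length (nbrs adj v)

_≤κ_ : ℕ → Maybe ℕ → Set
d ≤κ nothing = ⊤
d ≤κ just k = d ≤ k

rotateL : ∀ {A : Set} → ℕ → List A → List A
rotateL k xs = drop k xs ++ take k xs

CyclicListing : ∀ {A : Set} → List A → List A → Set
CyclicListing ws xs =
  Σ ℕ (λ k → ws ≡ rotateL k xs ⊎ ws ≡ rotateL k (reverse xs))

HasStar : ∀ {n} → PlaneGraph n → Vec (Maybe ℕ) 5 → Set
HasStar {n} G κ =
  Σ (Fin n) λ v → Σ (Vec (Fin n) 5) λ ws →
    deg v ≡ 5 × CyclicListing (toList ws) (rot v)
      × (∀ i → deg (lookup ws i) ≤κ lookup κ i)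
  where open PlaneGraph G

{-# OPTIONS --safe #-}
module Submission where

-- Discharging, in units of 1/20.  All faces have length at least 3, so Euler's formula makes the sum over all
-- vertices of 20 deg v − 120 + 10 · (number of corners at v in faces of length at least 4) negative.  Each vertex
-- of degree at least 10 (a big vertex) pays its neighbours of degree 5, the amount depending on the degrees seen
-- in the rotation around the recipient.  If no listed star occurs, every 5-vertex with its non-triangular corners
-- collects the missing 20 units.  The recipients around a big vertex form a cyclic word of tiles, in which
-- neighbouring tiles constrain each other; among the words of length 10, …, 14 the most expensive one is found by
-- max-plus dynamic programming, and for larger degrees a potential function bounds the average payment.

open import Defs
open import Data.Bool using (Bool; true; false; _∧_; _∨_; not; if_then_else_)
open import Data.Bool.ListAction using (all; any)
open import Data.Bool.Properties using (∨-zeroʳ; T-≡; ¬-not)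
open import Data.Empty using (⊥; ⊥-elim)
open import Data.Fin using (Fin; zero; suc; fromℕ<; toℕ; combine; _≟_)
open import Data.Fin.Properties using (any?; pigeonhole; combine-injective; toℕ-injective; toℕ<n; toℕ-combine; toℕ-fromℕ<)
open import Data.List using (List; []; _∷_; _++_; length; map; concatMap; filterᵇ; foldr; reverse; lookup; allFin; upTo)
open import Data.List.Membership.Propositional using (_∈_; _∉_; find; lose)
open import Data.List.Membership.Propositional.Properties using
  (∈-∃++; ∈-filter⁺; ∈-filter⁻; ∈-allFin; ∈-upTo⁺; ∈-concatMap⁺; ∈-concatMap⁻; ∈-map⁺; ∈-map⁻)
open import Data.List.Properties using
  (map-++; map-∘; length-map; length-filter; length-tabulate; take-all; drop-all; ++-identityʳ)
open import Data.List.Relation.Binary.Permutation.Propositional using (_↭_; ↭-sym; ↭⇒↭ₛ)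
open import Data.List.Relation.Binary.Permutation.Propositional.Properties using (shift; ∈-resp-↭; ↭-length)
  renaming (map⁺ to ↭-map⁺)
import Data.List.Relation.Binary.Permutation.Setoid.Properties as Permₛ
open import Data.List.Relation.Unary.All as All using (All; []; _∷_)
open import Data.List.Relation.Unary.AllPairs using ([]; _∷_)
open import Data.List.Relation.Unary.Any using (here; there; index)
open import Data.List.Relation.Unary.Any.Properties using (lookup-index)
open import Data.List.Relation.Unary.Unique.Propositional using (Unique)
open import Data.List.Relation.Unary.Unique.Propositional.Properties using (allFin⁺; filter⁺; ++⁺)
  renaming (map⁺ to Unique-map⁺)
open import Data.Maybe using (Maybe; just; nothing)
open import Data.Nat as ℕ using (ℕ; zero; suc; _+_; _*_; _∸_; _≤_; _<_; _≤ᵇ_; _≡ᵇ_; _⊔_; z≤n; s≤s)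
open import Data.Nat.ListAction using (sum)
open import Data.Nat.ListAction.Properties using (sum-++; sum-↭)
open import Data.Nat.Properties hiding (_≟_)
open import Data.Nat.Solver using (module +-*-Solver)
open import Data.Product using (_×_; _,_; Σ; ∃; proj₁; proj₂)
open import Data.Product.Properties using (≡-dec; ,-injective)
open import Data.Sum using (_⊎_; inj₁; inj₂)
open import Data.Unit using (tt)
open import Data.Vec as Vec using (Vec; _∷_; []; toList)
open import Function using (_∘_; _|>_; Equivalence)
open import Relation.Binary.PropositionalEquality
open import Relation.Binary.PropositionalEquality.Properties using (setoid)
open import Relation.Nullary using (¬_; Dec; yes; no; does; contradiction)
open import Relation.Nullary.Decidable using (T?; map′; _×-dec_; _⊎-dec_)

-- The surplus 20 d - 120 of a vertex of degree d amounts to 8 per neighbour at d = 10, to 12 at d =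
-- 15 and to 40/3 at d = 18. So a vertex of degree 10 cannot pay 10 units to every 5-vertex that it
-- shares with a second big vertex; where necessary the 20 units are split as 8 + 12, and the payer
-- of 12 needs compensation elsewhere, either from a larger degree or from a neighbour of degree at
-- least 6, which receives nothing. For the odd degrees 11 and 13 a bound on the average payment
-- cannot work, since the compatibility rules admit periodic words that are too expensive. Tiles
-- `tile 10 shut mate` alternating with their mirrors average 10 > 100/11, and at degree 13 the
-- weights 12, 12, 10, 10 can repeat with average 11 > 140/13. Their periods 2 and 4 do not divide
-- the degree, so the exact length of the cyclic word has to enter.

-- Finite sums over lists

∑ : {A : Set} → List A → (A → ℕ) → ℕ
∑ xs f = sum (map f xs)

module _ {A : Set} where

  ∑-+ : ∀ (xs : List A) (f g : A → ℕ) → ∑ xs (λ x → f x + g x) ≡ ∑ xs f + ∑ xs g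
  ∑-+ [] f g = refl
  ∑-+ (x ∷ xs) f g rewrite ∑-+ xs f g =
    solve 4 (λ a b c d → a :+ b :+ (c :+ d) := a :+ c :+ (b :+ d)) refl (f x) (g x) (∑ xs f) (∑ xs g)
    where open +-*-Solver

  ∑-mono : ∀ (xs : List A) {f g : A → ℕ} → (∀ x → x ∈ xs → f x ≤ g x) → ∑ xs f ≤ ∑ xs g
  ∑-mono [] h = z≤n
  ∑-mono (x ∷ xs) h = +-mono-≤ (h x (here refl)) (∑-mono xs λ y y∈ → h y (there y∈))

  ∑-cong : ∀ (xs : List A) {f g : A → ℕ} → (∀ x → x ∈ xs → f x ≡ g x) → ∑ xs f ≡ ∑ xs g
  ∑-cong [] h = refl
  ∑-cong (x ∷ xs) h = cong₂ _+_ (h x (here refl)) (∑-cong xs λ y y∈ → h y (there y∈))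

  ∑-* : ∀ (xs : List A) c (f : A → ℕ) → ∑ xs (λ x → c * f x) ≡ c * ∑ xs f
  ∑-* [] c f = sym (*-zeroʳ c)
  ∑-* (x ∷ xs) c f rewrite ∑-* xs c f = sym (*-distribˡ-+ c (f x) (∑ xs f))

  ∑-const : ∀ (xs : List A) c → ∑ xs (λ _ → c) ≡ length xs * c
  ∑-const [] c = refl
  ∑-const (x ∷ xs) c = cong (c +_) (∑-const xs c)

  ∑-filter : ∀ (p : A → Bool) xs (f : A → ℕ) → ∑ (filterᵇ p xs) f ≡ ∑ xs (λ x → if p x then f x else 0)
  ∑-filter p [] f = refl
  ∑-filter p (x ∷ xs) f with p x
  ... | true = cong (f x +_) (∑-filter p xs f)
  ... | false = ∑-filter p xs f

  ∑-↭ : ∀ {xs ys : List A} (f : A → ℕ) → xs ↭ ys → ∑ xs f ≡ ∑ ys f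
  ∑-↭ f p = sum-↭ (↭-map⁺ f p)

  -- The induction deletes one occurrence of `x` from `ys`; as `xs` has no repetition, its remaining
  -- entries survive the deletion.
  ∑-⊆ : ∀ {xs} (ys : List A) (f : A → ℕ) → Unique xs → (∀ {x} → x ∈ xs → x ∈ ys) → ∑ xs f ≤ ∑ ys f
  ∑-⊆ ys f [] _ = z≤n
  ∑-⊆ {x ∷ xs} ys f (x∉ ∷ u) sub with ∈-∃++ (sub (here refl))
  ... | as , bs , refl = begin
      f x + ∑ xs f           ≤⟨ +-monoʳ-≤ (f x) (∑-⊆ (as ++ bs) f u sub′) ⟩
      ∑ (x ∷ as ++ bs) f     ≡⟨ ∑-↭ f (shift x as bs) ⟨
      ∑ (as ++ x ∷ bs) f     ∎
    where
    open ≤-Reasoning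
    sub′ : ∀ {y} → y ∈ xs → y ∈ as ++ bs
    sub′ y∈ with ∈-resp-↭ (shift x as bs) (sub (there y∈))
    ... | here refl = contradiction refl (All.lookup x∉ y∈)
    ... | there q = q

module _ {A B : Set} where

  ∑-map : ∀ (g : A → B) xs (f : B → ℕ) → ∑ (map g xs) f ≡ ∑ xs (λ x → f (g x))
  ∑-map g xs f = cong sum (sym (map-∘ xs))

  ∑-concatMap : ∀ (g : A → List B) xs (f : B → ℕ) → ∑ (concatMap g xs) f ≡ ∑ xs (λ x → ∑ (g x) f)
  ∑-concatMap g [] f = refl
  ∑-concatMap g (x ∷ xs) f = begin
    sum (map f (g x ++ concatMap g xs))            ≡⟨ cong sum (map-++ f (g x) _) ⟩
    sum (map f (g x) ++ map f (concatMap g xs))    ≡⟨ sum-++ (map f (g x)) _ ⟩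
    ∑ (g x) f + ∑ (concatMap g xs) f               ≡⟨ cong (∑ (g x) f +_) (∑-concatMap g xs f) ⟩
    ∑ (g x) f + ∑ xs (λ x → ∑ (g x) f)             ∎
    where open ≡-Reasoning

  ∑-swap : ∀ (xs : List A) (ys : List B) (f : A → B → ℕ) →
    ∑ xs (λ x → ∑ ys (f x)) ≡ ∑ ys (λ y → ∑ xs (λ x → f x y))
  ∑-swap [] ys f = sym (trans (∑-const ys 0) (*-zeroʳ (length ys)))
  ∑-swap (x ∷ xs) ys f = trans (cong (∑ ys (f x) +_) (∑-swap xs ys f)) (sym (∑-+ ys (f x) _))

-- Cyclic successors

module _ {n : ℕ} where

  ==-refl : (x : Fin n) → (x == x) ≡ true
  ==-refl x with x ≟ x
  ... | yes _ = refl
  ... | no x≢x = contradiction refl x≢x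

  ==-≢ : {x y : Fin n} → x ≢ y → (x == y) ≡ false
  ==-≢ {x} {y} x≢y with x ≟ y
  ... | yes x≡y = contradiction x≡y x≢y
  ... | no _ = refl

  nextIn-∈ : ∀ f (x : Fin n) xs {u} → u ∈ x ∷ xs → nextIn f (x ∷ xs) u ∈ f ∷ xs
  nextIn-∈ f x [] u∈ = here refl
  nextIn-∈ f x (y ∷ xs) {u} u∈ with x ≟ u | u∈
  ... | yes _ | _ = there (here refl)
  ... | no x≢u | here refl = contradiction refl x≢u
  ... | no _ | there u∈′ with nextIn-∈ f y xs u∈′
  ...   | here eq = here eq
  ...   | there q = there (there q)

  -- The values taken on `x ∷ xs` are the entries of `xs` followed by `f`, so `f ∉ xs` keeps them
  -- distinct. The cyclic case is f = x.
  nextIn-injective : ∀ f (x : Fin n) xs {u w} → f ∉ xs → Unique (x ∷ xs) → u ∈ x ∷ xs → w ∈ x ∷ xs →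
    nextIn f (x ∷ xs) u ≡ nextIn f (x ∷ xs) w → u ≡ w
  nextIn-injective f x [] f∉ uq (here refl) (here refl) _ = refl
  nextIn-injective f x (y ∷ xs) {u} {w} f∉ (x∉ ∷ uq@(y∉ ∷ _)) u∈ w∈ eq with x ≟ u | x ≟ w | u∈ | w∈
  ... | yes refl | yes refl | _ | _ = refl
  ... | no x≢u | _ | here refl | _ = contradiction refl x≢u
  ... | _ | no x≢w | _ | here refl = contradiction refl x≢w
  ... | no _ | no _ | there p | there q = nextIn-injective f y xs (f∉ ∘ there) uq p q eq
  ... | yes refl | no _ | _ | there q = ⊥-elim (head-≢ (subst (_∈ f ∷ xs) (sym eq) (nextIn-∈ f y xs q)))
    where
    head-≢ : y ∉ f ∷ xs
    head-≢ (here refl) = f∉ (here refl)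
    head-≢ (there r) = All.lookup y∉ r refl
  ... | no _ | yes refl | there p | _ = ⊥-elim (head-≢ (subst (_∈ f ∷ xs) eq (nextIn-∈ f y xs p)))
    where
    head-≢ : y ∉ f ∷ xs
    head-≢ (here refl) = f∉ (here refl)
    head-≢ (there r) = All.lookup y∉ r refl

  nextIn-fixed : ∀ f (x : Fin n) xs {u} → f ∉ xs → Unique (x ∷ xs) → u ∈ x ∷ xs →
    nextIn f (x ∷ xs) u ≡ u → xs ≡ []
  nextIn-fixed f x [] f∉ uq u∈ eq = refl
  nextIn-fixed f x (y ∷ xs) {u} f∉ (x∉ ∷ uq) u∈ eq with x ≟ u | u∈
  ... | yes refl | _ = contradiction (sym eq) (All.lookup x∉ (here refl))
  ... | no x≢u | here refl = contradiction refl x≢u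
  ... | no _ | there p with nextIn-fixed f y xs (f∉ ∘ there) uq p eq
  nextIn-fixed f x (y ∷ []) f∉ _ _ eq | no _ | there (here refl) | refl = contradiction (here eq) f∉

  cycSucc-∈ : ∀ {xs} {u : Fin n} → u ∈ xs → cycSucc xs u ∈ xs
  cycSucc-∈ {x ∷ xs} u∈ = nextIn-∈ x x xs u∈

  cycSucc-injective : ∀ {xs} {u w : Fin n} → Unique xs → u ∈ xs → w ∈ xs → cycSucc xs u ≡ cycSucc xs w → u ≡ w
  cycSucc-injective {x ∷ xs} uq@(x∉ ∷ _) = nextIn-injective x x xs (λ x∈ → All.lookup x∉ x∈ refl) uq

  -- This will exclude faces of length two, in which the tail of a dart would be its own successor
  -- around the head.
  cycSucc-≢ : ∀ {xs} {u : Fin n} → Unique xs → 2 ≤ length xs → u ∈ xs → cycSucc xs u ≢ u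
  cycSucc-≢ {x ∷ xs} uq@(x∉ ∷ _) 2≤ u∈ eq with nextIn-fixed x x xs (λ x∈ → All.lookup x∉ x∈ refl) uq u∈ eq
  cycSucc-≢ {x ∷ .[]} _ (s≤s ()) _ _ | refl

-- The endpoint `z` is a separate index, so that z = x describes a cyclic word cut open at `x`.
data Chain {A : Set} (R : A → A → Set) : A → List A → A → Set where
  end  : ∀ {x z} → R x z → Chain R x [] z
  link : ∀ {x y ys z} → R x y → Chain R y ys z → Chain R x (y ∷ ys) z

module _ {n : ℕ} where

  nextIn-chain : ∀ {A : Set} {R : A → A → Set} (t : Fin n → A) f x xs → Unique (x ∷ xs) →
    (∀ u → u ∈ x ∷ xs → R (t u) (t (nextIn f (x ∷ xs) u))) → Chain R (t x) (map t xs) (t f)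
  nextIn-chain t f x [] uq h = end (h x (here refl))
  nextIn-chain {R = R} t f x (y ∷ xs) (x∉ ∷ uq) h =
    link (subst (λ b → R (t x) (t (if b then y else nextIn f (y ∷ xs) x))) (==-refl x) (h x (here refl)))
         (nextIn-chain t f y xs uq λ u u∈ →
           subst (λ b → R (t u) (t (if b then y else nextIn f (y ∷ xs) u))) (==-≢ (All.lookup x∉ u∈)) (h u (there u∈)))

  -- Both listings end in `w` because the fifth entry of each star has the weakest bound; it is the
  -- place of the big neighbour from which the others are counted.
  record Around (xs : List (Fin n)) (w : Fin n) : Set where
    next = cycSucc xs
    x₁ = next w
    x₂ = next x₁
    x₃ = next x₂
    x₄ = next x₃
    field
      closes : next x₄ ≡ w
      clockwise : CyclicListing (x₁ ∷ x₂ ∷ x₃ ∷ x₄ ∷ w ∷ []) xs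
      counterclockwise : CyclicListing (x₄ ∷ x₃ ∷ x₂ ∷ x₁ ∷ w ∷ []) xs
      exhaustive : ∀ {v} → v ∈ xs → v ∈ w ∷ x₁ ∷ x₂ ∷ x₃ ∷ x₄ ∷ []

  record Pentagon (xs : List (Fin n)) : Set where
    field
      {a b c d e} : Fin n
      shape : xs ≡ a ∷ b ∷ c ∷ d ∷ e ∷ []
      next-a : cycSucc xs a ≡ b
      next-b : cycSucc xs b ≡ c
      next-c : cycSucc xs c ≡ d
      next-d : cycSucc xs d ≡ e
      next-e : cycSucc xs e ≡ a

  pentagon : ∀ xs → Unique xs → length xs ≡ 5 → Pentagon xs
  pentagon (a ∷ b ∷ c ∷ d ∷ e ∷ []) ((a≢b ∷ a≢c ∷ a≢d ∷ a≢e ∷ []) ∷ (b≢c ∷ b≢d ∷ b≢e ∷ []) ∷ (c≢d ∷ c≢e ∷ []) ∷ (d≢e ∷ []) ∷ _) refl =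
    record { shape = refl ; next-a = na ; next-b = nb ; next-c = nc ; next-d = nd ; next-e = ne }
    where
    xs = a ∷ b ∷ c ∷ d ∷ e ∷ []
    na : cycSucc xs a ≡ b
    na rewrite ==-refl a = refl
    nb : cycSucc xs b ≡ c
    nb rewrite ==-≢ a≢b | ==-refl b = refl
    nc : cycSucc xs c ≡ d
    nc rewrite ==-≢ a≢c | ==-≢ b≢c | ==-refl c = refl
    nd : cycSucc xs d ≡ e
    nd rewrite ==-≢ a≢d | ==-≢ b≢d | ==-≢ c≢d | ==-refl d = refl
    ne : cycSucc xs e ≡ a
    ne rewrite ==-≢ a≢e | ==-≢ b≢e | ==-≢ c≢e | ==-≢ d≢e = refl

  around : ∀ {xs} → Pentagon xs → ∀ {w} → w ∈ xs → Around xs w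
  around {xs} record { shape = refl ; next-a = na ; next-b = nb ; next-c = nc ; next-d = nd ; next-e = ne } = at
    where
    start : ∀ {w x₁ x₂ x₃ x₄} → cycSucc xs w ≡ x₁ → cycSucc xs x₁ ≡ x₂ → cycSucc xs x₂ ≡ x₃ → cycSucc xs x₃ ≡ x₄ →
      cycSucc xs x₄ ≡ w → CyclicListing (x₁ ∷ x₂ ∷ x₃ ∷ x₄ ∷ w ∷ []) xs → CyclicListing (x₄ ∷ x₃ ∷ x₂ ∷ x₁ ∷ w ∷ []) xs →
      (∀ {v} → v ∈ xs → v ∈ w ∷ x₁ ∷ x₂ ∷ x₃ ∷ x₄ ∷ []) → Around xs w
    start refl refl refl refl e c cc ex = record { closes = e ; clockwise = c ; counterclockwise = cc ; exhaustive = ex }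

    turn : ∀ {v p q r s t : Fin n} → v ∈ p ∷ q ∷ r ∷ s ∷ t ∷ [] → v ∈ q ∷ r ∷ s ∷ t ∷ p ∷ []
    turn (here v≡p) = there (there (there (there (here v≡p))))
    turn (there (here v≡q)) = here v≡q
    turn (there (there (here v≡r))) = there (here v≡r)
    turn (there (there (there (here v≡s)))) = there (there (here v≡s))
    turn (there (there (there (there (here v≡t))))) = there (there (there (here v≡t)))

    at : ∀ {w} → w ∈ xs → Around xs w
    at (here refl) = start na nb nc nd ne (1 , inj₁ refl) (0 , inj₂ refl) λ v∈ → v∈
    at (there (here refl)) = start nb nc nd ne na (2 , inj₁ refl) (4 , inj₂ refl) turn
    at (there (there (here refl))) = start nc nd ne na nb (3 , inj₁ refl) (3 , inj₂ refl) λ v∈ → turn (turn v∈)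
    at (there (there (there (here refl)))) = start nd ne na nb nc (4 , inj₁ refl) (2 , inj₂ refl) λ v∈ → turn (turn (turn v∈))
    at (there (there (there (there (here refl))))) =
      start ne na nb nc nd (0 , inj₁ refl) (1 , inj₂ refl) λ v∈ → turn (turn (turn (turn v∈)))

-- Faces and Euler's formula

module _ {A : Set} where

  Unique-resp-↭ : {xs ys : List A} → xs ↭ ys → Unique xs → Unique ys
  Unique-resp-↭ p = Permₛ.Unique-resp-↭ (setoid A) (↭⇒↭ₛ p)

  ∈-filterᵇ⁻ : ∀ (p : A → Bool) {x} xs → x ∈ filterᵇ p xs → x ∈ xs × p x ≡ true
  ∈-filterᵇ⁻ p xs x∈ with ∈-filter⁻ (T? ∘ p) x∈
  ... | q , t = q , Equivalence.to T-≡ t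

  ∈-filterᵇ⁺ : ∀ (p : A → Bool) {x xs} → x ∈ xs → p x ≡ true → x ∈ filterᵇ p xs
  ∈-filterᵇ⁺ p x∈ e = ∈-filter⁺ (T? ∘ p) x∈ (Equivalence.from T-≡ e)

  all-lookup : ∀ (p : A → Bool) {x} xs → all p xs ≡ true → x ∈ xs → p x ≡ true
  all-lookup p (x ∷ xs) e x∈ with p x in px | x∈
  ... | true | here refl = px
  ... | true | there q = all-lookup p xs e q

  all-intro : ∀ (p : A → Bool) xs → (∀ x → x ∈ xs → p x ≡ true) → all p xs ≡ true
  all-intro p [] h = refl
  all-intro p (x ∷ xs) h rewrite h x (here refl) = all-intro p xs λ y y∈ → h y (there y∈)

  any-intro : ∀ (p : A → Bool) {x} xs → x ∈ xs → p x ≡ true → any p xs ≡ true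
  any-intro p (x ∷ xs) (here refl) e rewrite e = refl
  any-intro p (x ∷ xs) (there x∈) e rewrite any-intro p xs x∈ e = ∨-zeroʳ (p x)

  length-filter-none : ∀ (p : A → Bool) xs → (∀ x → p x ≡ false) → length (filterᵇ p xs) ≡ 0
  length-filter-none p [] h = refl
  length-filter-none p (x ∷ xs) h rewrite h x = length-filter-none p xs h

concatMap-unique : ∀ {A B : Set} (g : A → List B) {xs} → Unique xs → (∀ x → x ∈ xs → Unique (g x)) →
  (∀ {x y b} → x ∈ xs → y ∈ xs → b ∈ g x → b ∈ g y → x ≡ y) → Unique (concatMap g xs)
concatMap-unique g [] _ _ = []
concatMap-unique g {x ∷ xs} (x∉ ∷ uq) u h =
  ++⁺ (u x (here refl)) (concatMap-unique g uq (λ y y∈ → u y (there y∈)) λ p q → h (there p) (there q))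
    λ { (b∈x , b∈xs) → let y , y∈ , b∈y = find (∈-concatMap⁻ g {xs = xs} b∈xs)
                       in All.lookup x∉ y∈ (h (here refl) (there y∈) b∈x b∈y) }

module Faces {n : ℕ} (0<n : 0 < n) (G : PlaneGraph n) (mindeg : ∀ v → 5 ≤ PlaneGraph.deg G v) where
  open PlaneGraph G renaming (sym to adj-sym)
  open Embedding adj rot

  ∈-rot⁻ : ∀ {v u} → u ∈ rot v → adj v u ≡ true
  ∈-rot⁻ {v} u∈ = proj₂ (∈-filterᵇ⁻ (adj v) (allFin n) (∈-resp-↭ (rotNbrs v) u∈))

  ∈-rot⁺ : ∀ {v u} → adj v u ≡ true → u ∈ rot v
  ∈-rot⁺ {v} {u} e = ∈-resp-↭ (↭-sym (rotNbrs v)) (∈-filterᵇ⁺ (adj v) (∈-allFin u) e)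

  rot-sym : ∀ {u v} → u ∈ rot v → v ∈ rot u
  rot-sym {u} {v} u∈ = ∈-rot⁺ (trans (adj-sym u v) (∈-rot⁻ u∈))

  rot-unique : ∀ v → Unique (rot v)
  rot-unique v = Unique-resp-↭ (↭-sym (rotNbrs v)) (filter⁺ (T? ∘ adj v) (allFin⁺ n))

  length-rot : ∀ v → length (rot v) ≡ deg v
  length-rot v = ↭-length (rotNbrs v)

  IsDart : Dart n → Set
  IsDart (u , v) = u ∈ rot v

  face-dart : ∀ {d} → IsDart d → IsDart (faceStep d)
  face-dart {u , v} u∈ = rot-sym (cycSucc-∈ u∈)

  iter-dart : ∀ k {d} → IsDart d → IsDart (iter k d)
  iter-dart zero p = p
  iter-dart (suc k) p = face-dart (iter-dart k p)

  face-injective : ∀ {d e} → IsDart d → IsDart e → faceStep d ≡ faceStep e → d ≡ e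
  face-injective {u , v} {u′ , v′} p q eq with ,-injective eq
  ... | refl , s = cong (_, v) (cycSucc-injective (rot-unique v) p q s)

  iter-injective : ∀ k {d e} → IsDart d → IsDart e → iter k d ≡ iter k e → d ≡ e
  iter-injective zero p q eq = eq
  iter-injective (suc k) p q eq = iter-injective k p q (face-injective (iter-dart k p) (iter-dart k q) eq)

  iter-+ : ∀ j k d → iter (j + k) d ≡ iter j (iter k d)
  iter-+ zero k d = refl
  iter-+ (suc j) k d = cong faceStep (iter-+ j k d)

  face-≢ : ∀ {d} → IsDart d → faceStep d ≢ d
  face-≢ {u , v} p eq with ,-injective eq
  ... | refl , _ with trans (sym (∈-rot⁻ p)) (irrefl u)
  ...   | ()

  face²-≢ : ∀ {d} → IsDart d → iter 2 d ≢ d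
  face²-≢ {u , v} p eq = cycSucc-≢ (rot-unique v)
    (subst (2 ≤_) (sym (length-rot v)) (≤-trans (s≤s (s≤s z≤n)) (mindeg v))) p (cong proj₁ eq)

  -- Two of the first n² + 1 iterates coincide, and injectivity on darts cancels their common
  -- initial steps.
  period : ∀ {d} → IsDart d → ∃ λ q → 1 ≤ q × q ≤ n * n × iter q d ≡ d
  period {d} p with pigeonhole (n<1+n (n * n)) (λ k → combine (proj₁ (iter (toℕ k) d)) (proj₂ (iter (toℕ k) d)))
  ... | i , j , i<j , eq = toℕ j ∸ toℕ i , m<n⇒0<n∸m i<j , ≤-trans (m∸n≤m (toℕ j) (toℕ i)) (≤-pred (toℕ<n j)) ,
      sym (iter-injective (toℕ i) p (iter-dart (toℕ j ∸ toℕ i) p) (begin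
        iter (toℕ i) d                              ≡⟨ cong₂ _,_ (proj₁ eqs) (proj₂ eqs) ⟩
        iter (toℕ j) d                              ≡⟨ cong (λ k → iter k d) (m+[n∸m]≡n (<⇒≤ i<j)) ⟨
        iter (toℕ i + (toℕ j ∸ toℕ i)) d            ≡⟨ iter-+ (toℕ i) _ d ⟩
        iter (toℕ i) (iter (toℕ j ∸ toℕ i) d)       ∎))
    where
    open ≡-Reasoning
    eqs = combine-injective (proj₁ (iter (toℕ i) d)) (proj₂ (iter (toℕ i) d)) _ _ eq

  code-injective : ∀ d e → code d ≡ code e → d ≡ e
  code-injective (u , v) (u′ , v′) eq = cong₂ _,_ (proj₁ eqs) (proj₂ eqs)
    where
    code-combine : ∀ (a b : Fin n) → code (a , b) ≡ toℕ (combine a b)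
    code-combine a b = trans (cong (_+ toℕ b) (*-comm (toℕ a) n)) (sym (toℕ-combine a b))
    eqs = combine-injective u v u′ v′ (toℕ-injective (trans (sym (code-combine u v)) (trans eq (code-combine u′ v′))))

  rep-minimal : ∀ {d} → faceRep d ≡ true → ∀ {k} → k < n * n → code d ≤ code (iter k d)
  rep-minimal {d} r {k} k< = ≤ᵇ⇒≤ _ _ (Equivalence.from T-≡
    (all-lookup (λ k → code d ≤ᵇ code (iter k d)) (upTo (n * n)) r (∈-upTo⁺ k<)))

  3<n² : 3 < n * n
  3<n² = ≤-trans (*-mono-≤ 2≤n 2≤n) ≤-refl
    where
    v₀ = fromℕ< 0<n
    2≤n : 2 ≤ n
    2≤n = ≤-trans (s≤s (s≤s z≤n)) (≤-trans (mindeg v₀)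
      (≤-trans (length-filter (T? ∘ adj v₀) (allFin n)) (≤-reflexive (length-tabulate (λ (i : Fin n) → i)))))

  -- The orbit of e closes up within n² steps, so e is also reached from d and both codes are minimal.
  rep-unique : ∀ {d e} → IsDart e → faceRep d ≡ true → faceRep e ≡ true → ∀ p → p ≤ 3 → iter p e ≡ d → d ≡ e
  rep-unique {d} {e} e∈ rd re zero _ eq = sym eq
  rep-unique {d} {e} e∈ rd re p@(suc p-1) p≤3 eq with period e∈
  ... | q , 1≤q , q≤ , cyc with p ≤? q
  ...   | yes p≤q = code-injective d e (≤-antisym code≤ code≥)
    where
    code≥ : code e ≤ code d
    code≥ = subst (λ x → code e ≤ code x) eq (rep-minimal re (≤-trans (s≤s p≤3) 3<n²))
    back : iter (q ∸ p) d ≡ e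
    back = begin
      iter (q ∸ p) d              ≡⟨ cong (iter (q ∸ p)) eq ⟨
      iter (q ∸ p) (iter p e)     ≡⟨ iter-+ (q ∸ p) p e ⟨
      iter (q ∸ p + p) e          ≡⟨ cong (λ k → iter k e) (m∸n+n≡m p≤q) ⟩
      iter q e                    ≡⟨ cyc ⟩
      e                           ∎
      where open ≡-Reasoning
    code≤ : code d ≤ code e
    code≤ = subst (λ x → code d ≤ code x) back
      (rep-minimal rd (<-≤-trans (∸-monoʳ-< (s≤s z≤n) p≤q) q≤))
  rep-unique e∈ rd re (suc _) p≤3 eq | zero , () , _ , _ | no _
  rep-unique e∈ rd re (suc _) p≤3 eq | suc zero , _ , _ , cyc | no _ = ⊥-elim (face-≢ e∈ cyc)
  rep-unique e∈ rd re (suc _) p≤3 eq | suc (suc zero) , _ , _ , cyc | no _ = ⊥-elim (face²-≢ e∈ cyc)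
  rep-unique e∈ rd re (suc _) p≤3 eq | suc (suc (suc q)) , _ , _ , cyc | no p≰q =
    ⊥-elim (p≰q (≤-trans p≤3 (s≤s (s≤s (s≤s z≤n)))))

  triangular? : ∀ d → Dec (iter 3 d ≡ d)
  triangular? d = ≡-dec _≟_ _≟_ (iter 3 d) d

  excess : Dart n → ℕ
  excess d = if does (triangular? d) then 0 else 1

  -- A triangle has three darts of weight 4, any other face at least four darts of weight 3, hence total weight at least 12.
  weight : Dart n → ℕ
  weight d = if does (triangular? d) then 4 else 3

  weight+excess : ∀ d → weight d + excess d ≡ 4
  weight+excess d with does (triangular? d)
  ... | true = refl
  ... | false = refl

  -- A face is represented by its first three or four darts instead of its full orbit. Disjointness
  -- of these pieces suffices for counting, and orbit lengths never have to be computed.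
  segment : Dart n → List (Dart n)
  segment d = d ∷ faceStep d ∷ iter 2 d ∷ (if does (triangular? d) then [] else iter 3 d ∷ [])

  weight-face : ∀ {d} → IsDart d → weight (faceStep d) ≡ weight d
  weight-face {d} p with triangular? d | triangular? (faceStep d)
  ... | yes _ | yes _ = refl
  ... | no _ | no _ = refl
  ... | yes e | no ne = contradiction (cong faceStep e) ne
  ... | no ne | yes e = contradiction (face-injective (iter-dart 3 p) p e) ne

  weight-iter : ∀ k {d} → IsDart d → weight (iter k d) ≡ weight d
  weight-iter zero p = refl
  weight-iter (suc k) p = trans (weight-face (iter-dart k p)) (weight-iter k p)

  segment-weight : ∀ {d} → IsDart d → ∑ (segment d) weight ≡ 12
  segment-weight {d} p rewrite weight-face p | weight-iter 2 p with weight-iter 3 p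
  ... | w₃ with does (triangular? d)
  ...   | true = refl
  ...   | false rewrite w₃ = refl

  segment-∈⁻ : ∀ d {e} → e ∈ segment d → ∃ λ k → k ≤ 3 × iter k d ≡ e
  segment-∈⁻ d (here refl) = 0 , z≤n , refl
  segment-∈⁻ d (there (here refl)) = 1 , s≤s z≤n , refl
  segment-∈⁻ d (there (there (here refl))) = 2 , s≤s (s≤s z≤n) , refl
  segment-∈⁻ d (there (there (there e∈))) with does (triangular? d) | e∈
  ... | false | here refl = 3 , ≤-refl , refl
  ... | true | ()

  segment-unique : ∀ {d} → IsDart d → Unique (segment d)
  segment-unique {d} p with triangular? d
  ... | yes _ = (≢-sym (face-≢ p) ∷ ≢-sym (face²-≢ p) ∷ []) ∷ (≢-sym (face-≢ (face-dart p)) ∷ []) ∷ [] ∷ []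
  ... | no ne = (≢-sym (face-≢ p) ∷ ≢-sym (face²-≢ p) ∷ ≢-sym ne ∷ []) ∷
                (≢-sym (face-≢ (face-dart p)) ∷ ≢-sym (face²-≢ (face-dart p)) ∷ []) ∷
                (≢-sym (face-≢ (iter-dart 2 p)) ∷ []) ∷ [] ∷ []

  darts-∈⁻ : ∀ {d} → d ∈ darts → IsDart d
  darts-∈⁻ d∈ with find (∈-concatMap⁻ _ {xs = allFin n} d∈)
  ... | u , _ , d∈u with ∈-map⁻ (u ,_) d∈u
  ...   | v , v∈ , refl = rot-sym (∈-rot⁺ (proj₂ (∈-filterᵇ⁻ (adj u) (allFin n) v∈)))

  darts-∈⁺ : ∀ {d} → IsDart d → d ∈ darts
  darts-∈⁺ {u , v} p = ∈-concatMap⁺ _ (lose (∈-allFin u)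
    (∈-map⁺ (u ,_) (∈-filterᵇ⁺ (adj u) (∈-allFin v) (∈-rot⁻ (rot-sym p)))))

  darts-unique : Unique darts
  darts-unique = concatMap-unique _ (allFin⁺ n)
    (λ u _ → Unique-map⁺ (cong proj₂) (filter⁺ (T? ∘ adj u) (allFin⁺ n)))
    λ {x} {y} _ _ p q → let _ , _ , e = ∈-map⁻ (x ,_) p
                            _ , _ , e′ = ∈-map⁻ (y ,_) q
                        in cong proj₁ (trans (sym e) e′)

  reps = filterᵇ faceRep darts

  segments-disjoint : ∀ {r s d} → r ∈ reps → s ∈ reps → d ∈ segment r → d ∈ segment s → r ≡ s
  segments-disjoint {r} {s} r∈ s∈ d∈r d∈s with segment-∈⁻ r d∈r | segment-∈⁻ s d∈s
  ... | i , i≤3 , ei | j , j≤3 , ej with ∈-filterᵇ⁻ faceRep darts r∈ | ∈-filterᵇ⁻ faceRep darts s∈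
  ...   | r∈′ , rr | s∈′ , rs with ≤-total i j
  ...     | inj₁ i≤j = rep-unique s-dart rr rs (j ∸ i) (≤-trans (m∸n≤m j i) j≤3)
      (iter-injective i (iter-dart (j ∸ i) s-dart) r-dart
        (trans (sym (iter-+ i (j ∸ i) s)) (trans (cong (λ k → iter k s) (m+[n∸m]≡n i≤j)) (trans ej (sym ei)))))
    where
    r-dart = darts-∈⁻ r∈′
    s-dart = darts-∈⁻ s∈′
  ...     | inj₂ j≤i = sym (rep-unique r-dart rs rr (i ∸ j) (≤-trans (m∸n≤m i j) i≤3)
      (iter-injective j (iter-dart (i ∸ j) r-dart) s-dart
        (trans (sym (iter-+ j (i ∸ j) r)) (trans (cong (λ k → iter k r) (m+[n∸m]≡n j≤i)) (trans ei (sym ej))))))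
    where
    r-dart = darts-∈⁻ r∈′
    s-dart = darts-∈⁻ s∈′

  segments-⊆-darts : ∀ {d} → d ∈ concatMap segment reps → d ∈ darts
  segments-⊆-darts d∈ with find (∈-concatMap⁻ segment {xs = reps} d∈)
  ... | r , r∈ , d∈r with segment-∈⁻ r d∈r
  ...   | k , _ , refl = darts-∈⁺ (iter-dart k (darts-∈⁻ (proj₁ (∈-filterᵇ⁻ faceRep darts r∈))))

  -- The disjoint segments weigh 12 each, while all darts together weigh four times their number
  -- minus the total excess.
  face-bound : 12 * length reps + ∑ darts excess ≤ 4 * length darts
  face-bound = begin
    12 * length reps + ∑ darts excess                     ≡⟨ cong (_+ ∑ darts excess) (*-comm 12 (length reps)) ⟩
    length reps * 12 + ∑ darts excess                     ≡⟨ cong (_+ ∑ darts excess) (∑-const reps 12) ⟨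
    ∑ reps (λ _ → 12) + ∑ darts excess                    ≡⟨ cong (_+ ∑ darts excess) (∑-cong reps λ r r∈ → segment-weight (darts-∈⁻ (proj₁ (∈-filterᵇ⁻ faceRep darts r∈)))) ⟨
    ∑ reps (λ r → ∑ (segment r) weight) + ∑ darts excess  ≡⟨ cong (_+ ∑ darts excess) (∑-concatMap segment reps weight) ⟨
    ∑ (concatMap segment reps) weight + ∑ darts excess    ≤⟨ +-monoˡ-≤ _ (∑-⊆ darts weight segments-unique segments-⊆-darts) ⟩
    ∑ darts weight + ∑ darts excess                       ≡⟨ ∑-+ darts weight excess ⟨
    ∑ darts (λ d → weight d + excess d)                   ≡⟨ ∑-cong darts (λ d _ → weight+excess d) ⟩
    ∑ darts (λ _ → 4)                                     ≡⟨ ∑-const darts 4 ⟩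
    length darts * 4                                      ≡⟨ *-comm (length darts) 4 ⟩
    4 * length darts                                      ∎
    where
    open ≤-Reasoning
    segments-unique : Unique (concatMap segment reps)
    segments-unique = concatMap-unique segment (filter⁺ (T? ∘ faceRep) darts-unique)
      (λ r r∈ → segment-unique (darts-∈⁻ (proj₁ (∈-filterᵇ⁻ faceRep darts r∈)))) segments-disjoint

  none-isolated : length (filterᵇ isolated (allFin n)) ≡ 0
  none-isolated = length-filter-none isolated (allFin n) λ v → cong not (busy v)
    where
    busy : ∀ v → any (adj v) (allFin n) ≡ true
    busy v with rot v in e | length-rot v | mindeg v
    ... | [] | l | 5≤ = contradiction (subst (5 ≤_) (sym l) 5≤) λ ()
    ... | u ∷ _ | _ | _ = any-intro (adj v) (allFin n) (∈-allFin u) (∈-rot⁻ (subst (u ∈_) (sym e) (here refl)))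

  -- Vertex 0 has the least number, hence represents its component.
  component : 1 ≤ numComponents
  component = nonempty (∈-filterᵇ⁺ compRep (∈-allFin v₀) (all-intro _ (allFin n) λ w _ →
      trans (cong (not (reach v₀ n w) ∨_) (subst (λ k → (k ≤ᵇ toℕ w) ≡ true) (sym (toℕ-fromℕ< 0<n)) refl)) (∨-zeroʳ _)))
    where
    v₀ = fromℕ< 0<n
    nonempty : ∀ {v : Fin n} {xs} → v ∈ xs → 1 ≤ length xs
    nonempty {xs = _ ∷ _} _ = s≤s z≤n

  -- Double counting of adjacent pairs: it turns darts into corners at their heads, and later
  -- payments made into payments received.
  exchange : ∀ (g : Fin n → Fin n → ℕ) →
    ∑ (allFin n) (λ u → ∑ (nbrs adj u) (g u)) ≡ ∑ (allFin n) (λ v → ∑ (nbrs adj v) (λ u → g u v))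
  exchange g = begin
    ∑ (allFin n) (λ u → ∑ (nbrs adj u) (g u))
      ≡⟨ ∑-cong (allFin n) (λ u _ → ∑-filter (adj u) (allFin n) (g u)) ⟩
    ∑ (allFin n) (λ u → ∑ (allFin n) (λ v → if adj u v then g u v else 0))
      ≡⟨ ∑-swap (allFin n) (allFin n) _ ⟩
    ∑ (allFin n) (λ v → ∑ (allFin n) (λ u → if adj u v then g u v else 0))
      ≡⟨ ∑-cong (allFin n) (λ v _ → trans (∑-cong (allFin n) λ u _ → cong (if_then g u v else 0) (adj-sym u v))
                                          (sym (∑-filter (adj v) (allFin n) (λ u → g u v)))) ⟩
    ∑ (allFin n) (λ v → ∑ (nbrs adj v) (λ u → g u v)) ∎
    where open ≡-Reasoning

  corners : ∀ f → ∑ darts f ≡ ∑ (allFin n) (λ v → ∑ (rot v) (λ u → f (u , v)))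
  corners f = begin
    ∑ darts f                                                                  ≡⟨ ∑-concatMap _ (allFin n) f ⟩
    ∑ (allFin n) (λ u → ∑ (map (u ,_) (nbrs adj u)) f)                         ≡⟨ ∑-cong (allFin n) (λ u _ → ∑-map (u ,_) (nbrs adj u) f) ⟩
    ∑ (allFin n) (λ u → ∑ (nbrs adj u) (λ v → f (u , v)))                      ≡⟨ exchange (λ u v → f (u , v)) ⟩
    ∑ (allFin n) (λ v → ∑ (nbrs adj v) (λ u → f (u , v)))                      ≡⟨ ∑-cong (allFin n) (λ v _ → ∑-↭ _ (rotNbrs v)) ⟨
    ∑ (allFin n) (λ v → ∑ (rot v) (λ u → f (u , v)))                           ∎
    where
    open ≡-Reasoning

  degree-sum : length darts ≡ ∑ (allFin n) deg
  degree-sum = begin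
    length darts                                     ≡⟨ *-identityʳ _ ⟨
    length darts * 1                                 ≡⟨ ∑-const darts 1 ⟨
    ∑ darts (λ _ → 1)                                ≡⟨ corners (λ _ → 1) ⟩
    ∑ (allFin n) (λ v → ∑ (rot v) (λ _ → 1))         ≡⟨ ∑-cong (allFin n) (λ v _ → trans (∑-const (rot v) 1) (trans (*-identityʳ _) (length-rot v))) ⟩
    ∑ (allFin n) deg                                 ∎
    where open ≡-Reasoning

  spoilt : Fin n → ℕ
  spoilt v = ∑ (rot v) (λ u → excess (u , v))

  euler-bound : 2 * ∑ (allFin n) deg + ∑ (allFin n) spoilt + 24 ≤ 12 * n
  euler-bound = subst₂ (λ D E → 2 * D + E + 24 ≤ 12 * n) degree-sum (corners excess) (arith (length darts) (∑ darts excess) (length reps) numComponents n face-bound component euler′)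
    where
    euler′ : 2 * n + 2 * length reps ≡ length darts + 4 * numComponents
    euler′ = trans (cong (λ k → 2 * n + 2 * k) (sym (trans (cong (length reps +_) none-isolated) (+-identityʳ _)))) euler
    arith : ∀ D E F C n → 12 * F + E ≤ 4 * D → 1 ≤ C → 2 * n + 2 * F ≡ D + 4 * C → 2 * D + E + 24 ≤ 12 * n
    -- This is six times Euler's formula; adding `12 * F + 4 * D` on both sides replaces
    -- subtraction.
    arith D E F C n fb 1≤C eu = +-cancelʳ-≤ (12 * F + 4 * D) _ _ (begin
      2 * D + E + 24 + (12 * F + 4 * D)   ≡⟨ solve 3 (λ D E F → con 2 :* D :+ E :+ con 24 :+ (con 12 :* F :+ con 4 :* D) := con 12 :* F :+ E :+ (con 6 :* D :+ con 24)) refl D E F ⟩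
      12 * F + E + (6 * D + 24)           ≤⟨ +-mono-≤ fb (+-monoʳ-≤ (6 * D) (*-monoʳ-≤ 24 1≤C)) ⟩
      4 * D + (6 * D + 24 * C)            ≡⟨ solve 2 (λ D C → con 4 :* D :+ (con 6 :* D :+ con 24 :* C) := con 4 :* D :+ con 6 :* (D :+ con 4 :* C)) refl D C ⟩
      4 * D + 6 * (D + 4 * C)             ≡⟨ cong (λ k → 4 * D + 6 * k) eu ⟨
      4 * D + 6 * (2 * n + 2 * F)         ≡⟨ solve 3 (λ D F n → con 4 :* D :+ con 6 :* (con 2 :* n :+ con 2 :* F) := con 12 :* n :+ (con 12 :* F :+ con 4 :* D)) refl D F n ⟩
      12 * n + (12 * F + 4 * D)           ∎)
      where
      open ≤-Reasoning
      open +-*-Solver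

-- The discharging rules

∧-elimˡ : ∀ {a b} → a ∧ b ≡ true → a ≡ true
∧-elimˡ {true} _ = refl

∧-elimʳ : ∀ {a b} → a ∧ b ≡ true → b ≡ true
∧-elimʳ {true} e = e

∧-intro : ∀ {a b} → a ≡ true → b ≡ true → a ∧ b ≡ true
∧-intro refl refl = refl

record Finite (A : Set) : Set where
  field
    elems : List A
    complete : ∀ x → x ∈ elems
open Finite {{...}}

infixr 4 _⊃_

-- Statements quantified over finite types, proved by evaluating them; ⟦_⟧ is the meaning of a claim.
data Claim : Set₁ where
  claim : Bool → Claim
  _⊃_ : Bool → Claim → Claim
  ⋀ : ∀ {A} {{_ : Finite A}} → (A → Claim) → Claim

⟦_⟧ : Claim → Set
⟦ claim b ⟧ = b ≡ true
⟦ b ⊃ c ⟧ = b ≡ true → ⟦ c ⟧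
⟦ ⋀ f ⟧ = ∀ x → ⟦ f x ⟧

-- A failing hypothesis ends the branch before any later quantifier is expanded. The claims
-- therefore state each hypothesis as early as possible, which keeps the evaluation small.
check : Claim → Bool
check (claim b) = b
check (b ⊃ c) = if b then check c else true
check (⋀ f) = all (λ x → check (f x)) elems

verify : ∀ c → check c ≡ true → ⟦ c ⟧
verify (claim b) e = e
verify (true ⊃ c) e _ = verify c e
verify (⋀ f) e x = verify (f x) (all-lookup (λ y → check (f y)) elems e (complete x))

-- more means degree at least 11.
data Size : Set where
  five six ten more : Size

-- The degrees 10, 11, 12, 13–14, 15–17 and at least 18.
data Big : Set where
  ten eleven twelve thirteen fifteen eighteen : Big

-- Big vertices only distinguished as far as their payments differ: 10, 11–12, 13–14, at least 15.
data Rank : Set where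
  five six ten eleven thirteen fifteen : Rank

-- The number of non-triangular corners of a 5-vertex; if there is none, the flag is its mark, defined below.
data Corners : Set where
  triangular : Bool → Corners
  one many : Corners

-- Fix a big vertex B.  Each neighbour u of B shows one port to its predecessor and one to its successor around B.
-- isSix: u has degree at least 6; on all other ports u is a 5-vertex.
-- wantSix: the neighbour of B on this side has degree at least 6.
-- free, strict, toward, away: u has a non-triangular corner; strict excludes mates and shut ports on this side,
-- toward excludes shut ports, away excludes mates.
-- mate₁₀, mate: u has one further big neighbour A, and the neighbour of B on this side is adjacent to A as well;
-- mate₁₀ if A or B has degree 10.
-- shut, shut₁₂, shut₁₀: the side opposite to a mate; shut₁₂ if u gets 12 units, shut₁₀ if B has degree 10 and
-- gives u 10 units instead of 8.
data Port : Set where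
  isSix wantSix free strict toward away mate₁₀ mate open′ shut shut₁₂ shut₁₀ : Port

instance
  finite-Bool : Finite Bool
  finite-Bool = record { elems = true ∷ false ∷ [] ; complete = λ { true → here refl ; false → there (here refl) } }

  finite-Size : Finite Size
  finite-Size = record { elems = five ∷ six ∷ ten ∷ more ∷ [] ; complete = λ
    { five → here refl ; six → there (here refl) ; ten → there (there (here refl)) ; more → there (there (there (here refl))) } }

  finite-Big : Finite Big
  finite-Big = record { elems = ten ∷ eleven ∷ twelve ∷ thirteen ∷ fifteen ∷ eighteen ∷ [] ; complete = λ
    { ten → here refl ; eleven → there (here refl) ; twelve → there (there (here refl))
    ; thirteen → there (there (there (here refl))) ; fifteen → there (there (there (there (here refl))))
    ; eighteen → there (there (there (there (there (here refl))))) } }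

  finite-Rank : Finite Rank
  finite-Rank = record { elems = five ∷ six ∷ ten ∷ eleven ∷ thirteen ∷ fifteen ∷ [] ; complete = λ
    { five → here refl ; six → there (here refl) ; ten → there (there (here refl))
    ; eleven → there (there (there (here refl))) ; thirteen → there (there (there (there (here refl))))
    ; fifteen → there (there (there (there (there (here refl))))) } }

  finite-Corners : Finite Corners
  finite-Corners = record { elems = triangular true ∷ triangular false ∷ one ∷ many ∷ [] ; complete = λ
    { (triangular true) → here refl ; (triangular false) → there (here refl)
    ; one → there (there (here refl)) ; many → there (there (there (here refl))) } }

  finite-Port : Finite Port
  finite-Port = record
    { elems = isSix ∷ wantSix ∷ free ∷ strict ∷ toward ∷ away ∷ mate₁₀ ∷ mate ∷ open′ ∷ shut ∷ shut₁₂ ∷ shut₁₀ ∷ []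
    ; complete = λ
      { isSix → here refl ; wantSix → there (here refl) ; free → there (there (here refl))
      ; strict → there (there (there (here refl))) ; toward → there (there (there (there (here refl))))
      ; away → there (there (there (there (there (here refl)))))
      ; mate₁₀ → there (there (there (there (there (there (here refl))))))
      ; mate → there (there (there (there (there (there (there (here refl)))))))
      ; open′ → there (there (there (there (there (there (there (there (here refl))))))))
      ; shut → there (there (there (there (there (there (there (there (there (here refl)))))))))
      ; shut₁₂ → there (there (there (there (there (there (there (there (there (there (here refl))))))))))
      ; shut₁₀ → there (there (there (there (there (there (there (there (there (there (there (here refl))))))))))) } }

same? : {A : Set} {{_ : Finite A}} → A → A → Bool
same? x y = index (complete x) == index (complete y)

same?-sound : {A : Set} {{_ : Finite A}} (x y : A) → same? x y ≡ true → x ≡ y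
same?-sound x y e with index (complete x) ≟ index (complete y)
... | yes i = trans (lookup-index (complete x)) (trans (cong (lookup elems) i) (sym (lookup-index (complete y))))

rank : Big → Rank
rank ten = ten
rank eleven = eleven
rank twelve = eleven
rank thirteen = thirteen
rank fifteen = fifteen
rank eighteen = fifteen

size : Rank → Size
size five = five
size six = six
size ten = ten
size _ = more

big? is5 is10 le6 le10 : Size → Bool
big? ten = true
big? more = true
big? _ = false
is5 five = true
is5 _ = false
is10 ten = true
is10 _ = false
le6 five = true
le6 six = true
le6 _ = false
le10 more = false
le10 _ = true

le11 le12 le17 : Big → Bool
le11 ten = true
le11 eleven = true
le11 _ = false
le12 twelve = true
le12 b = le11 b
le17 eighteen = false
le17 _ = true

all-triangular? : Corners → Bool
all-triangular? (triangular _) = true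
all-triangular? _ = false

record Tile : Set where
  constructor tile
  field
    wt : ℕ
    left right : Port
open Tile public

mirror : Tile → Tile
mirror (tile w l r) = tile w r l

-- u has precisely the big neighbours B, of rank r, and y, separated by x₄; the flag is the mark of u.
mateTile : Rank → Size → Size → Size → Size → Bool → Tile
mateTile r x₁ x₂ x₃ six b = tile 10 open′ wantSix
mateTile eleven _ _ more _ b = tile 10 shut mate
mateTile thirteen _ _ more _ b = tile 10 shut mate
mateTile ten five five more _ true = tile 10 shut₁₀ mate₁₀
mateTile ten five five _ _ b = tile 8 shut mate₁₀
mateTile r five five _ _ true = tile 10 shut mate₁₀
mateTile r five five _ _ false = tile 12 shut₁₂ mate₁₀
mateTile r five _ _ _ b = tile 8 shut mate₁₀
mateTile r _ five _ _ b = tile 12 wantSix mate₁₀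
mateTile r _ _ _ _ b = tile 10 wantSix open′

loneTile : Size → Size → Tile
loneTile five _ = tile 20 open′ wantSix
loneTile _ five = tile 20 wantSix open′
loneTile _ _ = tile 20 wantSix wantSix

triangularTile : Rank → Size → Size → Size → Size → Bool → Tile
triangularTile r x₁ x₂ x₃ x₄ b =
  if big? x₁ then tile 10 wantSix open′ else
  if big? x₄ then tile 10 open′ wantSix else
  if big? x₂ then (if big? x₃ then tile 0 open′ open′ else mirror (mateTile r x₄ x₃ x₂ x₁ b)) else
  if big? x₃ then mateTile r x₁ x₂ x₃ x₄ b else loneTile x₁ x₄

oneTile : Size → Size → Size → Size → Tile
oneTile x₁ x₂ x₃ x₄ =
  if big? x₁ then tile 5 strict free else
  if big? x₄ then tile 5 free strict else
  if big? x₂ then (if big? x₃ then tile 0 free free else tile 5 toward away) else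
  if big? x₃ then tile 5 away toward else tile 10 strict strict

-- The payment of a vertex B of rank r to a 5-vertex u whose other neighbours in rotation order after B have sizes
-- x₁, x₂, x₃, x₄; the left port faces x₁ and the right port faces x₄.
tileOf : Rank → Size → Size → Size → Size → Corners → Tile
tileOf five _ _ _ _ _ = tile 0 isSix isSix
tileOf six _ _ _ _ _ = tile 0 isSix isSix
tileOf fifteen x₁ x₂ x₃ x₄ (triangular b) =
  if big? x₁ ∨ big? x₂ ∨ big? x₃ ∨ big? x₄ then tile 12 open′ open′ else loneTile x₁ x₄
tileOf fifteen x₁ x₂ x₃ x₄ _ = tile 12 open′ open′
tileOf r x₁ x₂ x₃ x₄ (triangular b) = triangularTile r x₁ x₂ x₃ x₄ b
tileOf r x₁ x₂ x₃ x₄ one = oneTile x₁ x₂ x₃ x₄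
tileOf r x₁ x₂ x₃ x₄ many = tile 0 free free

-- A face of length l ≥ 4 has charge 20 (2l − 6) ≥ 10 l, hence affords 10 units per corner.
slack : Corners → ℕ
slack (triangular _) = 0
slack one = 10
slack many = 20

gift : Rank → Rank → Rank → Rank → Rank → Corners → ℕ
gift b x₁ x₂ x₃ x₄ φ = wt (tileOf b (size x₁) (size x₂) (size x₃) (size x₄) φ)

low? : Rank → Bool
low? ten = true
low? eleven = true
low? _ = false

-- If B and its partner x₃ both had degree 10 here, each would pay only 8 to a recipient with
-- triangular corners; the star with bounds 5, 5, 10, 5, 12 rules this out.
noLowPair : Rank → Size → Size → Size → Size → Bool
noLowPair b x₁ x₂ x₃ x₄ = not (low? b ∧ is5 x₁ ∧ is5 x₂ ∧ is10 x₃ ∧ is5 x₄)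

noLowPairs : Rank → Rank → Rank → Rank → Rank → Bool
noLowPairs b x₁ x₂ x₃ x₄ =
  noLowPair b (size x₁) (size x₂) (size x₃) (size x₄) ∧ noLowPair b (size x₄) (size x₃) (size x₂) (size x₁)

five-paid-claim : Claim
five-paid-claim = ⋀ λ a → ⋀ λ b → ⋀ λ c → ⋀ λ d → ⋀ λ e →
  big? (size a) ∨ big? (size b) ∨ big? (size c) ∨ big? (size d) ∨ big? (size e) ⊃
  noLowPairs a b c d e ∧ noLowPairs b c d e a ∧ noLowPairs c d e a b ∧ noLowPairs d e a b c ∧ noLowPairs e a b c d ⊃
  ⋀ λ φ → claim (20 ≤ᵇ slack φ +
    (gift a b c d e φ + (gift b c d e a φ + (gift c d e a b φ + (gift d e a b c φ + (gift e a b c d φ + 0))))))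

five-paid : ⟦ five-paid-claim ⟧
five-paid = verify five-paid-claim refl

isMate isShut : Port → Bool
isMate mate₁₀ = true
isMate mate = true
isMate _ = false
isShut shut = true
isShut shut₁₂ = true
isShut shut₁₀ = true
isShut _ = false

-- For ports of consecutive 5-vertices that are adjacent, the third vertex common to both decides: a
-- mate makes it the further big vertex, a shut side makes it small. `mate` and `mate₁₀` exclude
-- each other because both describe the degrees of B and of this same vertex.
conflict : Port → Port → Bool
conflict wantSix isSix = false
conflict wantSix _ = true
conflict strict q = isMate q ∨ isShut q
conflict toward q = isShut q
conflict away q = isMate q
conflict mate₁₀ mate = true
conflict mate₁₀ q = isShut q
conflict mate q = isShut q
conflict shut₁₂ shut₁₂ = true
conflict shut₁₀ q = isShut q
conflict _ _ = false

fits : Port → Port → Bool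
fits p q = not (conflict p q ∨ conflict q p)

Fits : Tile → Tile → Set
Fits s t = fits (right s) (left t) ≡ true

-- b is the fifth neighbour, between x₄ and x₁; starless₁ tests one orientation only.
starless₁ starless : Big → Size → Size → Size → Size → Bool
starless₁ b x₁ x₂ x₃ x₄ =
  not (is5 x₁ ∧ le6 x₂ ∧ le6 x₃ ∧ is5 x₄) ∧
  not (is5 x₁ ∧ le6 x₂ ∧ le6 x₃ ∧ le6 x₄ ∧ le17 b) ∧
  not (le6 x₁ ∧ le6 x₂ ∧ le6 x₃ ∧ le6 x₄ ∧ le11 b) ∧
  not (is5 x₁ ∧ is5 x₂ ∧ le10 x₃ ∧ is5 x₄ ∧ le12 b)
starless b x₁ x₂ x₃ x₄ = starless₁ b x₁ x₂ x₃ x₄ ∧ starless₁ b x₄ x₃ x₂ x₁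

more? : Size → Bool
more? more = true
more? _ = false

ten? : Big → Bool
ten? ten = true
ten? _ = false

marked? unmarked? : Corners → Bool
marked? (triangular b) = b
marked? _ = false
unmarked? (triangular b) = not b
unmarked? _ = false

-- Here a vertex of degree 10 pays 10 instead of 8, and the port facing x₄ is `shut₁₀`.
refund? : Big → Size → Size → Size → Size → Corners → Bool
refund? b x₁ x₂ x₃ x₄ φ = ten? b ∧ is5 x₁ ∧ more? x₂ ∧ is5 x₃ ∧ is5 x₄ ∧ marked? φ

-- If B has rank `thirteen`, this recipient gets 12 units and shows `shut₁₂` towards x₄.
loud? : Size → Size → Size → Size → Corners → Bool
loud? x₁ x₂ x₃ x₄ φ = is5 x₁ ∧ is10 x₂ ∧ is5 x₃ ∧ is5 x₄ ∧ unmarked? φ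

-- If two consecutive neighbours of B both have non-triangular corners, they may be non-adjacent and
-- nothing relates their tiles. Such tiles therefore only carry ports that fit one another.
loose : Port → Bool
loose isSix = true
loose free = true
loose strict = true
loose toward = true
loose away = true
loose open′ = true
loose _ = false

-- wheel-claim: if B sees the consecutive 5-vertices u, u′ and one of them has triangular corners only, then u and u′
-- are adjacent and share x₃, the second neighbour of u′.  The three negated hypotheses are met by the geometry.
six-right-claim six-left-claim loose-sides-claim wheel-claim : Claim
six-right-claim = ⋀ λ b → ⋀ λ x₁ → ⋀ λ x₂ → ⋀ λ x₃ → ⋀ λ x₄ → ⋀ λ φ →
  starless b x₁ x₂ x₃ x₄ ⊃ not (all-triangular? φ ∧ is5 x₄) ⊃
  claim (fits (right (tileOf (rank b) x₁ x₂ x₃ x₄ φ)) isSix)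
six-left-claim = ⋀ λ b → ⋀ λ x₁ → ⋀ λ x₂ → ⋀ λ x₃ → ⋀ λ x₄ → ⋀ λ φ →
  starless b x₁ x₂ x₃ x₄ ⊃ not (all-triangular? φ ∧ is5 x₁) ⊃
  claim (fits isSix (left (tileOf (rank b) x₁ x₂ x₃ x₄ φ)))
loose-sides-claim = ⋀ λ b → ⋀ λ x₁ → ⋀ λ x₂ → ⋀ λ x₃ → ⋀ λ x₄ → ⋀ λ φ →
  not (all-triangular? φ) ⊃
  claim (loose (left (tileOf (rank b) x₁ x₂ x₃ x₄ φ)) ∧ loose (right (tileOf (rank b) x₁ x₂ x₃ x₄ φ)))
wheel-claim = ⋀ λ b → ⋀ λ x₁ → ⋀ λ x₂ → ⋀ λ x₃ → ⋀ λ φ → starless b x₁ x₂ x₃ five ⊃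
  ⋀ λ ψ → all-triangular? φ ∨ all-triangular? ψ ⊃ ⋀ λ y₃ → ⋀ λ y₄ → starless b five x₃ y₃ y₄ ⊃
  not (loud? x₁ x₂ x₃ five φ ∧ loud? y₄ y₃ x₃ five ψ) ⊃
  not (refund? b x₁ x₂ x₃ five φ ∧ is5 y₄) ⊃ not (refund? b y₄ y₃ x₃ five ψ ∧ is5 x₁) ⊃
  claim (fits (right (tileOf (rank b) x₁ x₂ x₃ five φ)) (left (tileOf (rank b) five x₃ y₃ y₄ ψ)))

six-right : ⟦ six-right-claim ⟧
six-right = verify six-right-claim refl

six-left : ⟦ six-left-claim ⟧
six-left = verify six-left-claim refl

loose-sides : ⟦ loose-sides-claim ⟧
loose-sides = verify loose-sides-claim refl

wheel : ⟦ wheel-claim ⟧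
wheel = verify wheel-claim refl

loose-fits-claim : Claim
loose-fits-claim = ⋀ λ p → ⋀ λ q → loose p ⊃ loose q ⊃ claim (fits p q)

loose-fits : ⟦ loose-fits-claim ⟧
loose-fits = verify loose-fits-claim refl

-- Words of tiles around a big vertex

-- An entry (t , v) says that the heaviest path of tiles under consideration which ends in t has weight v.
Table : Set
Table = List (Tile × ℕ)

-- The maximum of no values is the empty list, which serves as -∞: a tile that no path reaches gets
-- no entry in the table.
maximum : List ℕ → List ℕ
maximum [] = []
maximum (x ∷ xs) = foldr _⊔_ x xs ∷ []

before : Tile → Table → List ℕ
before t [] = []
before t ((s , v) ∷ tbl) = if fits (right s) (left t) then v ∷ before t tbl else before t tbl

extend : List Tile → Table → Table
extend ts tbl = concatMap (λ t → map (λ v → t , wt t + v) (maximum (before t tbl))) ts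

extend^ : List Tile → ℕ → Table → Table
extend^ ts zero tbl = tbl
extend^ ts (suc k) tbl = extend^ ts k (extend ts tbl)

-- One start tile, `k` extensions and a last fit back to the start: this treats closed words of k +
-- 1 tiles, separately for each start.
bounded : List Tile → ℕ → ℕ → Bool
bounded ts k β = all (λ t → all (λ v → v ≤ᵇ β) (before t (extend^ ts k ((t , wt t) ∷ [])))) ts

maximum-≥ : ∀ {x} xs → x ∈ xs → ∃ λ m → m ∈ maximum xs × x ≤ m
maximum-≥ (y ∷ ys) x∈ = foldr _⊔_ y ys , here refl , ≥ ys x∈
  where
  ≥ : ∀ {x y} ys → x ∈ y ∷ ys → x ≤ foldr _⊔_ y ys
  ≥ [] (here refl) = ≤-refl
  ≥ (z ∷ zs) (here refl) = ≤-trans (≥ zs (here refl)) (m≤n⊔m z _)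
  ≥ (z ∷ zs) (there (here refl)) = m≤m⊔n z _
  ≥ (z ∷ zs) (there (there x∈)) = ≤-trans (≥ zs (there x∈)) (m≤n⊔m z _)

before-∈ : ∀ {s t v} tbl → Fits s t → (s , v) ∈ tbl → v ∈ before t tbl
before-∈ {s} {t} ((s′ , v′) ∷ tbl) f (here refl) rewrite f = here refl
before-∈ {s} {t} ((s′ , v′) ∷ tbl) f (there p) with fits (right s′) (left t)
... | true = there (before-∈ tbl f p)
... | false = before-∈ tbl f p

extend-∈ : ∀ {ts s t v} tbl → t ∈ ts → Fits s t → (s , v) ∈ tbl → ∃ λ m → (t , m) ∈ extend ts tbl × wt t + v ≤ m
extend-∈ {t = t} tbl t∈ f p with maximum-≥ (before t tbl) (before-∈ tbl f p)
... | m , m∈ , v≤m = wt t + m , ∈-concatMap⁺ _ (lose t∈ (∈-map⁺ _ m∈)) , +-monoʳ-≤ (wt t) v≤m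

extend^-∈ : ∀ {ts s z v} us tbl → All (_∈ ts) us → Chain Fits s us z → (s , v) ∈ tbl →
  ∃ λ m → m ∈ before z (extend^ ts (length us) tbl) × ∑ us wt + v ≤ m
extend^-∈ [] tbl [] (end f) p = _ , before-∈ tbl f p , ≤-refl
extend^-∈ {ts} {v = v} (u ∷ us) tbl (u∈ ∷ us∈) (link f c) p with extend-∈ tbl u∈ f p
... | m , m∈ , um≤ with extend^-∈ us (extend ts tbl) us∈ c m∈
...   | m′ , m′∈ , us≤ = m′ , m′∈ , (begin
  wt u + ∑ us wt + v    ≡⟨ cong (_+ v) (+-comm (wt u) (∑ us wt)) ⟩
  ∑ us wt + wt u + v    ≡⟨ +-assoc (∑ us wt) (wt u) v ⟩
  ∑ us wt + (wt u + v)  ≤⟨ +-monoʳ-≤ (∑ us wt) um≤ ⟩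
  ∑ us wt + m           ≤⟨ us≤ ⟩
  m′                    ∎)
  where open ≤-Reasoning

bounded-sound : ∀ ts k β → bounded ts k β ≡ true → ∀ t us → t ∈ ts → All (_∈ ts) us → Chain Fits t us t →
  length us ≡ k → ∑ (t ∷ us) wt ≤ β
bounded-sound ts k β ok t us t∈ us∈ c refl with extend^-∈ us ((t , wt t) ∷ []) us∈ c (here refl)
... | m , m∈ , ≤m = begin
  wt t + ∑ us wt   ≡⟨ +-comm (wt t) (∑ us wt) ⟩
  ∑ us wt + wt t   ≤⟨ ≤m ⟩
  m                ≤⟨ ≤ᵇ⇒≤ m β (Equivalence.from T-≡ (all-lookup (_≤ᵇ β) _ (all-lookup row ts ok t∈) m∈)) ⟩
  β                ∎
  where
  open ≤-Reasoning
  row : Tile → Bool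
  row t = all (_≤ᵇ β) (before t (extend^ ts (length us) ((t , wt t) ∷ [])))

-- in′ and out measure credit passed along the word from a tile to the next one.
potential-bound : ∀ (c β : ℕ) (in′ out : Port → ℕ) ts →
  (∀ t → t ∈ ts → c * wt t + out (right t) ≤ β + in′ (left t)) →
  (∀ s t → s ∈ ts → t ∈ ts → Fits s t → in′ (left t) ≤ out (right s)) →
  ∀ t us → t ∈ ts → All (_∈ ts) us → Chain Fits t us t → c * ∑ (t ∷ us) wt ≤ length (t ∷ us) * β
potential-bound c β in′ out ts local flow t us t∈ us∈ ch =
  +-cancelʳ-≤ (in′ (left t)) _ _ (go t us t∈ us∈ t∈ ch)
  where
  open ≤-Reasoning
  open +-*-Solver
  go : ∀ s us {z} → s ∈ ts → All (_∈ ts) us → z ∈ ts → Chain Fits s us z →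
    c * ∑ (s ∷ us) wt + in′ (left z) ≤ length (s ∷ us) * β + in′ (left s)
  go s [] {z} s∈ [] z∈ (end f) = begin
    c * (wt s + 0) + in′ (left z)   ≡⟨ cong (λ k → c * k + in′ (left z)) (+-identityʳ (wt s)) ⟩
    c * wt s + in′ (left z)         ≤⟨ +-monoʳ-≤ (c * wt s) (flow s z s∈ z∈ f) ⟩
    c * wt s + out (right s)        ≤⟨ local s s∈ ⟩
    β + in′ (left s)                ≡⟨ cong (_+ in′ (left s)) (+-identityʳ β) ⟨
    β + 0 + in′ (left s)            ∎
  go s (u ∷ us) {z} s∈ (u∈ ∷ us∈) z∈ (link f ch) = begin
    c * (wt s + ∑ (u ∷ us) wt) + in′ (left z)
      ≡⟨ solve 4 (λ c w W i → c :* (w :+ W) :+ i := c :* w :+ (c :* W :+ i)) refl c (wt s) (∑ (u ∷ us) wt) (in′ (left z)) ⟩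
    c * wt s + (c * ∑ (u ∷ us) wt + in′ (left z))
      ≤⟨ +-monoʳ-≤ (c * wt s) (go u us u∈ us∈ z∈ ch) ⟩
    c * wt s + (length (u ∷ us) * β + in′ (left u))
      ≤⟨ +-monoʳ-≤ (c * wt s) (+-monoʳ-≤ (length (u ∷ us) * β) (flow s u s∈ u∈ f)) ⟩
    c * wt s + (length (u ∷ us) * β + out (right s))
      ≡⟨ solve 3 (λ w L o → w :+ (L :+ o) := L :+ (w :+ o)) refl (c * wt s) (length (u ∷ us) * β) (out (right s)) ⟩
    length (u ∷ us) * β + (c * wt s + out (right s))
      ≤⟨ +-monoʳ-≤ (length (u ∷ us) * β) (local s s∈) ⟩
    length (u ∷ us) * β + (β + in′ (left s))
      ≡⟨ solve 3 (λ L b i → L :+ (b :+ i) := b :+ L :+ i) refl (length (u ∷ us) * β) β (in′ (left s)) ⟩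
    length (s ∷ u ∷ us) * β + in′ (left s) ∎

with-mirrors : List Tile → List Tile
with-mirrors [] = []
with-mirrors (t ∷ ts) = t ∷ mirror t ∷ with-mirrors ts

-- The excluded stars show in what is absent. A payment of 20 needs degree at least 12 because of
-- the bound 11; it needs vertices of degree at least 6 on both sides up to degree 17, and on at
-- least one side from 18 on. `shut₁₂` is absent up to degree 12.
tiles₁₀ tiles₁₁ tiles₁₂ tiles₁₃ tiles₁₅ tiles₁₈ common : List Tile
common = tile 0 isSix isSix ∷ tile 0 free free ∷ tile 0 open′ open′ ∷
  with-mirrors (tile 5 strict free ∷ tile 5 toward away ∷ tile 8 shut mate₁₀ ∷ tile 10 open′ wantSix ∷ tile 12 wantSix mate₁₀ ∷ [])
tiles₁₀ = with-mirrors (tile 10 shut₁₀ mate₁₀ ∷ []) ++ common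
tiles₁₁ = with-mirrors (tile 10 shut mate ∷ []) ++ common
tiles₁₂ = tile 10 strict strict ∷ tile 20 wantSix wantSix ∷ tiles₁₁
tiles₁₃ = with-mirrors (tile 10 shut mate₁₀ ∷ tile 12 shut₁₂ mate₁₀ ∷ []) ++ tiles₁₂
tiles₁₅ = tile 0 isSix isSix ∷ tile 12 open′ open′ ∷ tile 20 wantSix wantSix ∷ []
tiles₁₈ = tile 20 open′ wantSix ∷ tile 20 wantSix open′ ∷ tiles₁₅

tiles : Big → List Tile
tiles ten = tiles₁₀
tiles eleven = tiles₁₁
tiles twelve = tiles₁₂
tiles thirteen = tiles₁₃
tiles fifteen = tiles₁₅
tiles eighteen = tiles₁₈

same-tile? : Tile → Tile → Bool
same-tile? (tile w l r) (tile w′ l′ r′) = (w ≡ᵇ w′) ∧ same? l l′ ∧ same? r r′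

same-tile?-sound : ∀ s t → same-tile? s t ≡ true → s ≡ t
same-tile?-sound (tile w l r) (tile w′ l′ r′) e
  with refl ← ≡ᵇ⇒≡ w w′ (Equivalence.from T-≡ (∧-elimˡ {w ≡ᵇ w′} e))
     | refl ← same?-sound l l′ (∧-elimˡ {same? l l′} (∧-elimʳ {w ≡ᵇ w′} e))
     | refl ← same?-sound r r′ (∧-elimʳ {same? l l′} (∧-elimʳ {w ≡ᵇ w′} e)) = refl

any-same⇒∈ : ∀ t ts → any (same-tile? t) ts ≡ true → t ∈ ts
any-same⇒∈ t (s ∷ ts) e with same-tile? t s in eq
... | true = here (same-tile?-sound t s eq)
... | false = there (any-same⇒∈ t ts e)

available-claim : Claim
available-claim = ⋀ λ b → ⋀ λ x₁ → ⋀ λ x₂ → ⋀ λ x₃ → ⋀ λ x₄ → ⋀ λ φ →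
  starless b x₁ x₂ x₃ x₄ ⊃ claim (any (same-tile? (tileOf (rank b) x₁ x₂ x₃ x₄ φ)) (tiles b))

available : ⟦ available-claim ⟧
available = verify available-claim refl

bigOf : ℕ → Big
bigOf d =
  if d ≤ᵇ 10 then ten else if d ≤ᵇ 11 then eleven else if d ≤ᵇ 12 then twelve else
  if d ≤ᵇ 14 then thirteen else if d ≤ᵇ 17 then fifteen else eighteen

-- For degrees 15 to 17 the average is 12: a vertex of degree 6 or more saves 12 and passes 8 of
-- them on to a following payment of 20. From 18 on, all values are tripled and the average is 40/3,
-- attained by the word 20, 20, 0.
in₁₅ out₁₅ in₁₈ out₁₈ : Port → ℕ
in₁₅ wantSix = 8
in₁₅ _ = 0
out₁₅ isSix = 8
out₁₅ _ = 0
in₁₈ isSix = 0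
in₁₈ wantSix = 40
in₁₈ _ = 20
out₁₈ isSix = 40
out₁₈ wantSix = 0
out₁₈ _ = 20

potential-ok : ℕ → ℕ → (Port → ℕ) → (Port → ℕ) → List Tile → Bool
potential-ok c β in′ out ts =
  all (λ t → (c * wt t + out (right t) ≤ᵇ β + in′ (left t))) ts ∧
  all (λ s → all (λ t → not (fits (right s) (left t)) ∨ (in′ (left t) ≤ᵇ out (right s))) ts) ts

potential-ok-sound : ∀ (c β : ℕ) (in′ out : Port → ℕ) ts → potential-ok c β in′ out ts ≡ true →
  ∀ t us → t ∈ ts → All (_∈ ts) us → Chain Fits t us t → c * ∑ (t ∷ us) wt ≤ length (t ∷ us) * β
potential-ok-sound c β in′ out ts ok = potential-bound c β in′ out ts
  (λ t t∈ → ≤ᵇ⇒≤ _ _ (Equivalence.from T-≡ (all-lookup _ ts (∧-elimˡ ok) t∈)))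
  λ s t s∈ t∈ f → ≤ᵇ⇒≤ _ _ (Equivalence.from T-≡ (subst (λ b → not b ∨ (in′ (left t) ≤ᵇ out (right s)) ≡ true) f
    (all-lookup (λ t → not (fits (right s) (left t)) ∨ (in′ (left t) ≤ᵇ out (right s))) ts
      (all-lookup (λ s → all (λ t → not (fits (right s) (left t)) ∨ (in′ (left t) ≤ᵇ out (right s))) ts) ts (∧-elimʳ ok) s∈) t∈)))

fifteen-budget : ∀ d → 120 + d * 12 ≤ 20 * d → ∀ t us → t ∈ tiles₁₅ → All (_∈ tiles₁₅) us → Chain Fits t us t →
  length (t ∷ us) ≡ d → 120 + ∑ (t ∷ us) wt ≤ 20 * d
fifteen-budget d ≤20d t us t∈ us∈ c refl = ≤-trans (+-monoʳ-≤ 120 (≤-trans (≤-reflexive (sym (*-identityˡ _)))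
  (potential-ok-sound 1 12 in₁₅ out₁₅ tiles₁₅ refl t us t∈ us∈ c))) ≤20d

eighteen-budget : ∀ d → 18 ≤ d → ∀ t us → t ∈ tiles₁₈ → All (_∈ tiles₁₈) us → Chain Fits t us t →
  length (t ∷ us) ≡ d → 120 + ∑ (t ∷ us) wt ≤ 20 * d
eighteen-budget d 18≤d t us t∈ us∈ c refl = *-cancelˡ-≤ 3 (begin
  3 * (120 + ∑ (t ∷ us) wt)     ≡⟨ *-distribˡ-+ 3 120 (∑ (t ∷ us) wt) ⟩
  360 + 3 * ∑ (t ∷ us) wt       ≤⟨ +-mono-≤ (*-monoʳ-≤ 20 18≤d) (potential-ok-sound 3 40 in₁₈ out₁₈ tiles₁₈ refl t us t∈ us∈ c) ⟩
  20 * d + d * 40               ≡⟨ solve 1 (λ d → con 20 :* d :+ d :* con 40 := con 3 :* (con 20 :* d)) refl d ⟩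
  3 * (20 * d)                  ∎)
  where
  open ≤-Reasoning
  open +-*-Solver

big-budget : ∀ k t us → let d = 10 + k in t ∈ tiles (bigOf d) → All (_∈ tiles (bigOf d)) us → Chain Fits t us t →
  length (t ∷ us) ≡ d → 120 + ∑ (t ∷ us) wt ≤ 20 * d
-- The bounds 80, 100, 120, 140, 160 are 20 d - 120 for d = 10, ..., 14.
big-budget 0 t us t∈ us∈ c l = +-monoʳ-≤ 120 (bounded-sound tiles₁₀ 9 80 refl t us t∈ us∈ c (suc-injective l))
big-budget 1 t us t∈ us∈ c l = +-monoʳ-≤ 120 (bounded-sound tiles₁₁ 10 100 refl t us t∈ us∈ c (suc-injective l))
big-budget 2 t us t∈ us∈ c l = +-monoʳ-≤ 120 (bounded-sound tiles₁₂ 11 120 refl t us t∈ us∈ c (suc-injective l))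
big-budget 3 t us t∈ us∈ c l = +-monoʳ-≤ 120 (bounded-sound tiles₁₃ 12 140 refl t us t∈ us∈ c (suc-injective l))
big-budget 4 t us t∈ us∈ c l = +-monoʳ-≤ 120 (bounded-sound tiles₁₃ 13 160 refl t us t∈ us∈ c (suc-injective l))
big-budget 5 = fifteen-budget 15 (≤ᵇ⇒≤ 300 300 _)
big-budget 6 = fifteen-budget 16 (≤ᵇ⇒≤ 312 320 _)
big-budget 7 = fifteen-budget 17 (≤ᵇ⇒≤ 324 340 _)
big-budget (suc (suc (suc (suc (suc (suc (suc (suc j)))))))) = eighteen-budget (18 + j) (m≤m+n 18 j)

budget : ∀ d → 10 ≤ d → ∀ t us → t ∈ tiles (bigOf d) → All (_∈ tiles (bigOf d)) us → Chain Fits t us t →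
  length (t ∷ us) ≡ d → 120 + ∑ (t ∷ us) wt ≤ 20 * d
budget d 10≤d with m≤n⇒∃[o]m+o≡n 10≤d
... | k , refl = big-budget k

six-available : ∀ b → tile 0 isSix isSix ∈ tiles b
six-available ten = any-same⇒∈ _ tiles₁₀ refl
six-available eleven = any-same⇒∈ _ tiles₁₁ refl
six-available twelve = any-same⇒∈ _ tiles₁₂ refl
six-available thirteen = any-same⇒∈ _ tiles₁₃ refl
six-available fifteen = any-same⇒∈ _ tiles₁₅ refl
six-available eighteen = any-same⇒∈ _ tiles₁₈ refl

rankOf : ℕ → Rank
rankOf d = if d ≤ᵇ 5 then five else if d ≤ᵇ 6 then six else rank (bigOf d)

rank-big : ∀ d → 10 ≤ d → rankOf d ≡ rank (bigOf d)
rank-big d 10≤d with m≤n⇒∃[o]m+o≡n 10≤d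
... | k , refl = refl

capᵇ : Big → ℕ
capᵇ ten = 10
capᵇ eleven = 11
capᵇ twelve = 12
capᵇ thirteen = 14
capᵇ _ = 17

capˢ : Size → ℕ
capˢ five = 5
capˢ six = 6
capˢ _ = 10

≤ᵇ-true : ∀ {m} k → (m ≤ᵇ k) ≡ true → m ≤ k
≤ᵇ-true {m} k e = ≤ᵇ⇒≤ m k (Equivalence.from T-≡ e)

bigOf-cap : ∀ d → le17 (bigOf d) ≡ true → d ≤ capᵇ (bigOf d)
bigOf-cap d h with d ≤ᵇ 10 in e₁ | d ≤ᵇ 11 in e₂ | d ≤ᵇ 12 in e₃ | d ≤ᵇ 14 in e₄ | d ≤ᵇ 17 in e₅
... | true | _ | _ | _ | _ = ≤ᵇ-true 10 e₁
... | false | true | _ | _ | _ = ≤ᵇ-true 11 e₂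
... | false | false | true | _ | _ = ≤ᵇ-true 12 e₃
... | false | false | false | true | _ = ≤ᵇ-true 14 e₄
... | false | false | false | false | true = ≤ᵇ-true 17 e₅

le17⇒≤ : ∀ d → le17 (bigOf d) ≡ true → d ≤ 17
le17⇒≤ d h = ≤-trans (bigOf-cap d h) (cap≤ (bigOf d))
  where
  cap≤ : ∀ b → capᵇ b ≤ 17
  cap≤ ten = ≤ᵇ⇒≤ 10 17 _
  cap≤ eleven = ≤ᵇ⇒≤ 11 17 _
  cap≤ twelve = ≤ᵇ⇒≤ 12 17 _
  cap≤ thirteen = ≤ᵇ⇒≤ 14 17 _
  cap≤ fifteen = ≤-refl
  cap≤ eighteen = ≤-refl

le12⇒≤ : ∀ d → le12 (bigOf d) ≡ true → d ≤ 12
le12⇒≤ d h = ≤-trans (bigOf-cap d (le17-le12 (bigOf d) h)) (cap≤ (bigOf d) h)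
  where
  le17-le12 : ∀ b → le12 b ≡ true → le17 b ≡ true
  le17-le12 ten _ = refl
  le17-le12 eleven _ = refl
  le17-le12 twelve _ = refl
  cap≤ : ∀ b → le12 b ≡ true → capᵇ b ≤ 12
  cap≤ ten _ = ≤ᵇ⇒≤ 10 12 _
  cap≤ eleven _ = ≤ᵇ⇒≤ 11 12 _
  cap≤ twelve _ = ≤-refl

le11⇒≤ : ∀ d → le11 (bigOf d) ≡ true → d ≤ 11
le11⇒≤ d h = ≤-trans (bigOf-cap d (le17-le11 (bigOf d) h)) (cap≤ (bigOf d) h)
  where
  le17-le11 : ∀ b → le11 b ≡ true → le17 b ≡ true
  le17-le11 ten _ = refl
  le17-le11 eleven _ = refl
  cap≤ : ∀ b → le11 b ≡ true → capᵇ b ≤ 11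
  cap≤ ten _ = ≤ᵇ⇒≤ 10 11 _
  cap≤ eleven _ = ≤-refl

low⇒≤ : ∀ d → low? (rankOf d) ≡ true → d ≤ 12
low⇒≤ d h with d ≤ᵇ 5 | d ≤ᵇ 6
... | false | false = le12⇒≤ d (low-le12 (bigOf d) h)
  where
  low-le12 : ∀ b → low? (rank b) ≡ true → le12 b ≡ true
  low-le12 ten _ = refl
  low-le12 eleven _ = refl
  low-le12 twelve _ = refl

sizeOf : ℕ → Size
sizeOf d = size (rankOf d)

sizeOf-cap : ∀ d → le10 (sizeOf d) ≡ true → d ≤ capˢ (sizeOf d)
sizeOf-cap d h with d ≤ᵇ 5 in e₁ | d ≤ᵇ 6 in e₂
... | true | _ = ≤ᵇ-true 5 e₁
... | false | true = ≤ᵇ-true 6 e₂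
... | false | false with bigOf d | bigOf-cap d | h
...   | ten | cap | _ = cap refl

le10⇒≤ : ∀ d → le10 (sizeOf d) ≡ true → d ≤ 10
le10⇒≤ d h = ≤-trans (sizeOf-cap d h) (cap≤ (sizeOf d))
  where
  cap≤ : ∀ s → capˢ s ≤ 10
  cap≤ five = ≤ᵇ⇒≤ 5 10 _
  cap≤ six = ≤ᵇ⇒≤ 6 10 _
  cap≤ ten = ≤-refl
  cap≤ more = ≤-refl

le6⇒≤ : ∀ d → le6 (sizeOf d) ≡ true → d ≤ 6
le6⇒≤ d h = ≤-trans (sizeOf-cap d (le10-le6 (sizeOf d) h)) (cap≤ (sizeOf d) h)
  where
  le10-le6 : ∀ s → le6 s ≡ true → le10 s ≡ true
  le10-le6 five _ = refl
  le10-le6 six _ = refl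
  cap≤ : ∀ s → le6 s ≡ true → capˢ s ≤ 6
  cap≤ five _ = ≤ᵇ⇒≤ 5 6 _
  cap≤ six _ = ≤-refl

is5⇒≡ : ∀ {s} → is5 s ≡ true → s ≡ five
is5⇒≡ {five} _ = refl

is10⇒≡ : ∀ {s} → is10 s ≡ true → s ≡ ten
is10⇒≡ {ten} _ = refl

is5⇒≤ : ∀ d → is5 (sizeOf d) ≡ true → d ≤ 5
is5⇒≤ d h = subst (λ s → d ≤ capˢ s) (is5⇒≡ h) (sizeOf-cap d (cong le10 (is5⇒≡ h)))

-- Applying the rules to the graph

not-true : ∀ {b} → ¬ (b ≡ true) → not b ≡ true
not-true {true} h = ⊥-elim (h refl)
not-true {false} h = refl

any-elim : ∀ {A : Set} (p : A → Bool) xs → any p xs ≡ true → ∃ λ x → x ∈ xs × p x ≡ true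
any-elim p (x ∷ xs) e with p x in px
... | true = x , here refl , px
... | false with any-elim p xs e
...   | y , y∈ , py = y , there y∈ , py

cornersOf : ℕ → Bool → Corners
cornersOf 0 b = triangular b
cornersOf 1 b = one
cornersOf (suc (suc _)) b = many

slack-cornersOf : ∀ k b → slack (cornersOf k b) ≤ 10 * k
slack-cornersOf 0 b = z≤n
slack-cornersOf 1 b = ≤-refl
slack-cornersOf (suc (suc k)) b = *-monoʳ-≤ 10 {2} {suc (suc k)} (s≤s (s≤s z≤n))

all-triangular-0 : ∀ k b → all-triangular? (cornersOf k b) ≡ true → k ≡ 0
all-triangular-0 0 b _ = refl
all-triangular-0 1 b ()
all-triangular-0 (suc (suc _)) b ()

marked-0 : ∀ k b → marked? (cornersOf k b) ≡ true → k ≡ 0 × b ≡ true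
marked-0 0 b e = refl , e
marked-0 1 b ()
marked-0 (suc (suc _)) b ()

unmarked-0 : ∀ k b → unmarked? (cornersOf k b) ≡ true → k ≡ 0 × b ≡ false
unmarked-0 0 false e = refl , refl
unmarked-0 0 true ()
unmarked-0 1 b ()
unmarked-0 (suc (suc _)) b ()

bool-cases : ∀ b → b ≡ true ⊎ b ≡ false
bool-cases true = inj₁ refl
bool-cases false = inj₂ refl

module Discharge {n : ℕ} (0<n : 0 < n) (G : PlaneGraph n)
  (mindeg : ∀ v → 5 ≤ PlaneGraph.deg G v)
  (no7 : ∀ v → PlaneGraph.deg G v ≢ 7) (no8 : ∀ v → PlaneGraph.deg G v ≢ 8) (no9 : ∀ v → PlaneGraph.deg G v ≢ 9)
  (noA : ¬ HasStar G (just 5 ∷ just 6 ∷ just 6 ∷ just 5 ∷ nothing ∷ []))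
  (noB : ¬ HasStar G (just 5 ∷ just 6 ∷ just 6 ∷ just 6 ∷ just 17 ∷ []))
  (noC : ¬ HasStar G (just 6 ∷ just 6 ∷ just 6 ∷ just 6 ∷ just 11 ∷ []))
  (noD : ¬ HasStar G (just 5 ∷ just 5 ∷ just 10 ∷ just 5 ∷ just 12 ∷ []))
  where
  open PlaneGraph G renaming (sym to adj-sym)
  open Embedding adj rot using (iter)
  open Faces 0<n G mindeg

  σ : Fin n → Fin n → Fin n
  σ v = cycSucc (rot v)

  κ : Fin n → Size
  κ v = sizeOf (deg v)

  is5-deg : ∀ {v} → is5 (κ v) ≡ true → deg v ≡ 5
  is5-deg {v} e = ≤-antisym (is5⇒≤ (deg v) e) (mindeg v)

  five-around : ∀ {u w} → deg u ≡ 5 → w ∈ rot u → Around (rot u) w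
  five-around {u} e = around (pentagon (rot u) (rot-unique u) (trans (length-rot u) e))

  degree-cases : ∀ v → deg v ≡ 5 ⊎ deg v ≡ 6 ⊎ 10 ≤ deg v
  degree-cases v with deg v | mindeg v | no7 v | no8 v | no9 v
  ... | 0 | () | _ | _ | _
  ... | 1 | s≤s () | _ | _ | _
  ... | 2 | s≤s (s≤s ()) | _ | _ | _
  ... | 3 | s≤s (s≤s (s≤s ())) | _ | _ | _
  ... | 4 | s≤s (s≤s (s≤s (s≤s ()))) | _ | _ | _
  ... | 5 | _ | _ | _ | _ = inj₁ refl
  ... | 6 | _ | _ | _ | _ = inj₂ (inj₁ refl)
  ... | 7 | _ | n7 | _ | _ = contradiction refl n7
  ... | 8 | _ | _ | n8 | _ = contradiction refl n8
  ... | 9 | _ | _ | _ | n9 = contradiction refl n9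
  ... | suc (suc (suc (suc (suc (suc (suc (suc (suc (suc k))))))))) | _ | _ | _ | _ = inj₂ (inj₂ (m≤m+n 10 k))

  module _ {u : Fin n} (5≡ : deg u ≡ 5) {a b c d e : Fin n} (l : CyclicListing (a ∷ b ∷ c ∷ d ∷ e ∷ []) (rot u)) where

    ws : Vec (Fin n) 5
    ws = a ∷ b ∷ c ∷ d ∷ e ∷ []

    not-A : deg a ≤ 5 → deg b ≤ 6 → deg c ≤ 6 → deg d ≤ 5 → ⊥
    not-A p q r s = noA (u , ws , 5≡ , l , λ { zero → p ; (suc zero) → q ; (suc (suc zero)) → r ; (suc (suc (suc zero))) → s ; (suc (suc (suc (suc zero)))) → tt })

    not-B : deg a ≤ 5 → deg b ≤ 6 → deg c ≤ 6 → deg d ≤ 6 → deg e ≤ 17 → ⊥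
    not-B p q r s t = noB (u , ws , 5≡ , l , λ { zero → p ; (suc zero) → q ; (suc (suc zero)) → r ; (suc (suc (suc zero))) → s ; (suc (suc (suc (suc zero)))) → t })

    not-C : deg a ≤ 6 → deg b ≤ 6 → deg c ≤ 6 → deg d ≤ 6 → deg e ≤ 11 → ⊥
    not-C p q r s t = noC (u , ws , 5≡ , l , λ { zero → p ; (suc zero) → q ; (suc (suc zero)) → r ; (suc (suc (suc zero))) → s ; (suc (suc (suc (suc zero)))) → t })

    not-D : deg a ≤ 5 → deg b ≤ 5 → deg c ≤ 10 → deg d ≤ 5 → deg e ≤ 12 → ⊥
    not-D p q r s t = noD (u , ws , 5≡ , l , λ { zero → p ; (suc zero) → q ; (suc (suc zero)) → r ; (suc (suc (suc zero))) → s ; (suc (suc (suc (suc zero)))) → t })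

    starless₁-holds : starless₁ (bigOf (deg e)) (κ a) (κ b) (κ c) (κ d) ≡ true
    starless₁-holds =
      ∧-intro (not-true λ h → let p = ∧-elimʳ {is5 (κ a)} h ; q = ∧-elimʳ {le6 (κ b)} p in
        not-A (is5⇒≤ _ (∧-elimˡ h)) (le6⇒≤ _ (∧-elimˡ p)) (le6⇒≤ _ (∧-elimˡ q)) (is5⇒≤ _ (∧-elimʳ {le6 (κ c)} q)))
      (∧-intro (not-true λ h → let p = ∧-elimʳ {is5 (κ a)} h ; q = ∧-elimʳ {le6 (κ b)} p ; r = ∧-elimʳ {le6 (κ c)} q in
        not-B (is5⇒≤ _ (∧-elimˡ h)) (le6⇒≤ _ (∧-elimˡ p)) (le6⇒≤ _ (∧-elimˡ q)) (le6⇒≤ _ (∧-elimˡ r)) (le17⇒≤ _ (∧-elimʳ {le6 (κ d)} r)))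
      (∧-intro (not-true λ h → let p = ∧-elimʳ {le6 (κ a)} h ; q = ∧-elimʳ {le6 (κ b)} p ; r = ∧-elimʳ {le6 (κ c)} q in
        not-C (le6⇒≤ _ (∧-elimˡ h)) (le6⇒≤ _ (∧-elimˡ p)) (le6⇒≤ _ (∧-elimˡ q)) (le6⇒≤ _ (∧-elimˡ r)) (le11⇒≤ _ (∧-elimʳ {le6 (κ d)} r)))
      (not-true λ h → let p = ∧-elimʳ {is5 (κ a)} h ; q = ∧-elimʳ {is5 (κ b)} p ; r = ∧-elimʳ {le10 (κ c)} q in
        not-D (is5⇒≤ _ (∧-elimˡ h)) (is5⇒≤ _ (∧-elimˡ p)) (le10⇒≤ _ (∧-elimˡ q)) (is5⇒≤ _ (∧-elimˡ r)) (le12⇒≤ _ (∧-elimʳ {is5 (κ d)} r)))))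

    noLowPair-holds : noLowPair (rankOf (deg e)) (κ a) (κ b) (κ c) (κ d) ≡ true
    noLowPair-holds = not-true λ h →
      let p = ∧-elimʳ {low? (rankOf (deg e))} h ; q = ∧-elimʳ {is5 (κ a)} p ; r = ∧-elimʳ {is5 (κ b)} q ; s = ∧-elimʳ {is10 (κ c)} r in
      not-D (is5⇒≤ _ (∧-elimˡ p)) (is5⇒≤ _ (∧-elimˡ q)) (le10⇒≤ _ (cong le10 (is10⇒≡ (∧-elimˡ r)))) (is5⇒≤ _ s) (low⇒≤ _ (∧-elimˡ h))

  module _ (u : Fin n) where

    -- If d is the neighbour of u next to B, then B, u and d form a triangle and beyond is the neighbour of d after B
    -- on the far side of u.  If it has degree at least 6, then B pays it nothing, and a B of degree 10 can afford
    -- 10 instead of 8 units for u.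
    beyond⁺ beyond⁻ : Fin n → Fin n
    beyond⁺ B = σ (σ u B) B
    beyond⁻ B = σ w (σ w (σ w (σ w B)))
      where w = σ u (σ u (σ u (σ u B)))

    relieved : Fin n → Bool
    relieved B = is10 (κ B) ∧
      ((is5 (κ (σ u (σ u B))) ∧ not (is5 (κ (beyond⁺ B)))) ∨
       (is5 (κ (σ u (σ u (σ u B)))) ∧ not (is5 (κ (beyond⁻ B)))))

    -- The mark belongs to the recipient and not to a payer, so that a split 8 + 12 between degrees
    -- 10 and 13 or 14 becomes 10 + 10 on both sides at once.
    mark : Bool
    mark = any relieved (rot u)

    corner : Corners
    corner = cornersOf (spoilt u) mark

  tileAt : Fin n → Fin n → Tile
  tileAt B u = if is5 (κ u)
    then tileOf (rankOf (deg B)) (κ (σ u B)) (κ (σ u (σ u B))) (κ (σ u (σ u (σ u B)))) (κ (σ u (σ u (σ u (σ u B))))) (corner u)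
    else tile 0 isSix isSix

  give : Fin n → Fin n → ℕ
  give B u = wt (tileAt B u)

  triangle : ∀ {v w} → spoilt v ≡ 0 → w ∈ rot v → iter 3 (w , v) ≡ (w , v)
  triangle {v} {w} s w∈ with triangular? (w , v) in t
  ... | yes e = e
  ... | no _ = contradiction (∑-zero (rot v) s w∈) (λ z → 1≢0 (trans (sym (cong (λ d → if does d then 0 else 1) t)) z))
    where
    1≢0 : 1 ≢ 0
    1≢0 ()
    ∑-zero : ∀ xs {f : Fin n → ℕ} → ∑ xs f ≡ 0 → w ∈ xs → f w ≡ 0
    ∑-zero (x ∷ xs) {f} e (here refl) = m+n≡0⇒m≡0 (f x) e
    ∑-zero (x ∷ xs) {f} e (there p) = ∑-zero xs (m+n≡0⇒n≡0 (f x) e) p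

  -- The face through the dart `(w , v)` is a triangle, so tracing it gives one successor at each of
  -- the other two vertices.
  corner₁ : ∀ {v w} → spoilt v ≡ 0 → w ∈ rot v → σ (σ v w) v ≡ w
  corner₁ s w∈ = cong proj₁ (triangle s w∈)

  corner₂ : ∀ {v w} → spoilt v ≡ 0 → w ∈ rot v → σ w (σ v w) ≡ v
  corner₂ {v} {w} s w∈ = trans (cong (λ x → σ x (σ v w)) (sym (corner₁ s w∈))) (cong proj₂ (triangle s w∈))

  starless-at : ∀ {u B} → deg u ≡ 5 → B ∈ rot u →
    starless (bigOf (deg B)) (κ (σ u B)) (κ (σ u (σ u B))) (κ (σ u (σ u (σ u B)))) (κ (σ u (σ u (σ u (σ u B))))) ≡ true
  starless-at 5≡ B∈ = ∧-intro (starless₁-holds 5≡ (Around.clockwise a)) (starless₁-holds 5≡ (Around.counterclockwise a))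
    where a = five-around 5≡ B∈

  tileFor : Fin n → Fin n → Tile
  tileFor B u = tileOf (rank (bigOf (deg B)))
    (κ (σ u B)) (κ (σ u (σ u B))) (κ (σ u (σ u (σ u B)))) (κ (σ u (σ u (σ u (σ u B))))) (corner u)

  tile-five : ∀ {B u} → 10 ≤ deg B → is5 (κ u) ≡ true → tileAt B u ≡ tileFor B u
  tile-five {B} {u} 10≤ e = trans (cong (λ b → if b then T₁ (rankOf (deg B)) else tile 0 isSix isSix) e)
                                  (cong T₁ (rank-big (deg B) 10≤))
    where
    T₁ : Rank → Tile
    T₁ r = tileOf r (κ (σ u B)) (κ (σ u (σ u B))) (κ (σ u (σ u (σ u B)))) (κ (σ u (σ u (σ u (σ u B))))) (corner u)

  tile-other : ∀ {B u} → is5 (κ u) ≡ false → tileAt B u ≡ tile 0 isSix isSix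
  tile-other {B} {u} e rewrite e = refl

  -- Consecutive neighbours u and u′ of B bound the triangles B u u′ and u u′ x₃.
  shared : ∀ {u B} → deg u ≡ 5 → u ∈ rot B → spoilt u ≡ 0 ⊎ spoilt (σ B u) ≡ 0 →
    σ u (σ u (σ u (σ u B))) ≡ σ B u × σ (σ B u) B ≡ u × σ (σ B u) u ≡ σ u (σ u (σ u B))
  shared {u} {B} 5≡ u∈ (inj₁ s) = sym p , trans (cong (λ x → σ x B) p) q , trans (cong (λ x → σ x u) p) (corner₁ s x₃∈)
    where
    open Around (five-around 5≡ (rot-sym u∈))
    x₃∈ : x₃ ∈ rot u
    x₃∈ = cycSucc-∈ (cycSucc-∈ (cycSucc-∈ (rot-sym u∈)))
    p : σ B u ≡ x₄
    p = trans (cong (λ x → σ x u) (sym closes)) (corner₁ s (cycSucc-∈ x₃∈))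
    q : σ x₄ B ≡ u
    q = trans (cong (σ x₄) (sym closes)) (corner₂ s (cycSucc-∈ x₃∈))
  -- Now only the corners of `u′` are known to be triangles. They determine successors of the wanted
  -- vertices, and injectivity of the rotation recovers the vertices themselves.
  shared {u} {B} 5≡ u∈ (inj₂ s) = sym u′≡x₄ , x≡u , cycSucc-injective (rot-unique u) y∈ x₃∈ (trans (corner₂ s u∈′) u′≡x₄)
    where
    open Around (five-around 5≡ (rot-sym u∈))
    u′ = σ B u
    x₃∈ : x₃ ∈ rot u
    x₃∈ = cycSucc-∈ (cycSucc-∈ (cycSucc-∈ (rot-sym u∈)))
    B∈ : B ∈ rot u′
    B∈ = rot-sym (cycSucc-∈ u∈)
    x≡u : σ u′ B ≡ u
    x≡u = cycSucc-injective (rot-unique B) (subst (σ u′ B ∈_) (cong rot (corner₁ s B∈)) (iter-dart 2 {B , u′} B∈)) u∈ (corner₂ s B∈)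
    u∈′ : u ∈ rot u′
    u∈′ = subst (_∈ rot u′) x≡u (cycSucc-∈ B∈)
    u′≡x₄ : u′ ≡ x₄
    u′≡x₄ = cycSucc-injective (rot-unique u) (rot-sym u∈′) (cycSucc-∈ x₃∈)
      (trans (trans (cong (λ x → σ x u′) (sym x≡u)) (corner₁ s B∈)) (sym closes))
    y∈ : σ u′ u ∈ rot u
    y∈ = subst (σ u′ u ∈_) (cong rot (corner₁ s u∈′)) (iter-dart 2 {u , u′} u∈′)

  -- A mark may stem from any neighbour of degree 10; if no other neighbour has degree 10, it stems
  -- from `B`.
  relieved-only : ∀ {u B} → deg u ≡ 5 → B ∈ rot u → mark u ≡ true →
    is10 (κ (σ u B)) ≡ false → is10 (κ (σ u (σ u B))) ≡ false →
    is10 (κ (σ u (σ u (σ u B)))) ≡ false → is10 (κ (σ u (σ u (σ u (σ u B))))) ≡ false → relieved u B ≡ true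
  relieved-only {u} {B} 5≡ B∈ m n₁ n₂ n₃ n₄ with any-elim (relieved u) (rot u) m
  ... | A , A∈ , r with Around.exhaustive (five-around 5≡ B∈) A∈
  ...   | here refl = r
  ...   | there (here refl) = contradiction (trans (sym (∧-elimˡ r)) n₁) λ ()
  ...   | there (there (here refl)) = contradiction (trans (sym (∧-elimˡ r)) n₂) λ ()
  ...   | there (there (there (here refl))) = contradiction (trans (sym (∧-elimˡ r)) n₃) λ ()
  ...   | there (there (there (there (here refl)))) = contradiction (trans (sym (∧-elimˡ r)) n₄) λ ()

  five-not-ten : ∀ {s} → is5 s ≡ true → is10 s ≡ false
  five-not-ten {five} _ = refl

  more-not-ten : ∀ {s} → more? s ≡ true → is10 s ≡ false
  more-not-ten {more} _ = refl

  more-not-five : ∀ {s} → more? s ≡ true → is5 s ≡ false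
  more-not-five {more} _ = refl

  -- `beyond⁻ u B` is the entry y₄ of the next recipient. As its degree is not 5, that recipient is
  -- not shut towards `u`, which is what `shut₁₀` demands.
  refund⁻ : ∀ {u B} → deg u ≡ 5 → B ∈ rot u →
    refund? (bigOf (deg B)) (κ (σ u B)) (κ (σ u (σ u B))) (κ (σ u (σ u (σ u B)))) (κ (σ u (σ u (σ u (σ u B))))) (corner u) ≡ true →
    spoilt u ≡ 0 × is5 (κ (beyond⁻ u B)) ≡ false
  refund⁻ {u} {B} 5≡ B∈ h = proj₁ m , conclude (relieved-only 5≡ B∈ (proj₂ m) (five-not-ten (∧-elimˡ h₁)) (more-not-ten {κ (σ u (σ u B))} (∧-elimˡ h₂)) (five-not-ten (∧-elimˡ h₃)) (five-not-ten (∧-elimˡ h₄)))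
    where
    h₁ = ∧-elimʳ {ten? (bigOf (deg B))} h
    h₂ = ∧-elimʳ {is5 (κ (σ u B))} h₁
    h₃ = ∧-elimʳ {more? (κ (σ u (σ u B)))} h₂
    h₄ = ∧-elimʳ {is5 (κ (σ u (σ u (σ u B))))} h₃
    m = marked-0 (spoilt u) (mark u) (∧-elimʳ {is5 (κ (σ u (σ u (σ u (σ u B)))))} h₄)
    conclude : relieved u B ≡ true → is5 (κ (beyond⁻ u B)) ≡ false
    conclude r with is10 (κ B) | is5 (κ (σ u (σ u B))) | more-not-five {κ (σ u (σ u B))} (∧-elimˡ h₂) | is5 (κ (σ u (σ u (σ u B)))) | is5 (κ (beyond⁻ u B))
    ... | true | false | _ | true | false = refl

  refund⁺ : ∀ {u B} → deg u ≡ 5 → B ∈ rot u →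
    refund? (bigOf (deg B)) (κ (σ u (σ u (σ u (σ u B))))) (κ (σ u (σ u (σ u B)))) (κ (σ u (σ u B))) (κ (σ u B)) (corner u) ≡ true →
    spoilt u ≡ 0 × is5 (κ (beyond⁺ u B)) ≡ false
  refund⁺ {u} {B} 5≡ B∈ h = proj₁ m , conclude (relieved-only 5≡ B∈ (proj₂ m) (five-not-ten (∧-elimˡ h₄)) (five-not-ten (∧-elimˡ h₃)) (more-not-ten {κ (σ u (σ u (σ u B)))} (∧-elimˡ h₂)) (five-not-ten (∧-elimˡ h₁)))
    where
    h₁ = ∧-elimʳ {ten? (bigOf (deg B))} h
    h₂ = ∧-elimʳ {is5 (κ (σ u (σ u (σ u (σ u B)))))} h₁
    h₃ = ∧-elimʳ {more? (κ (σ u (σ u (σ u B))))} h₂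
    h₄ = ∧-elimʳ {is5 (κ (σ u (σ u B)))} h₃
    m = marked-0 (spoilt u) (mark u) (∧-elimʳ {is5 (κ (σ u B))} h₄)
    conclude : relieved u B ≡ true → is5 (κ (beyond⁺ u B)) ≡ false
    conclude r with is10 (κ B) | is5 (κ (σ u (σ u B))) | is5 (κ (σ u (σ u (σ u B)))) | more-not-five {κ (σ u (σ u (σ u B)))} (∧-elimˡ h₂) | is5 (κ (beyond⁺ u B))
    ... | true | true | false | _ | false = refl

  any-false : ∀ {A : Set} (p : A → Bool) {x} xs → x ∈ xs → any p xs ≡ false → p x ≡ false
  any-false p xs x∈ e = ¬-not λ px → contradiction (trans (sym (any-intro p xs x∈ px)) e) λ ()

  -- Two adjacent recipients of 12 units with different mates have a common 5-neighbour d = x₃ with neighbourhood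
  -- 5, 5, 10, 5, 10.
  loud-clash : ∀ {u B} → deg u ≡ 5 → deg (σ B u) ≡ 5 → u ∈ rot B →
    let u′ = σ B u in
    loud? (κ (σ u B)) (κ (σ u (σ u B))) (κ (σ u (σ u (σ u B)))) five (corner u) ≡ true →
    loud? (κ (σ u′ (σ u′ (σ u′ (σ u′ B))))) (κ (σ u′ (σ u′ (σ u′ B)))) (κ (σ u (σ u (σ u B)))) five (corner u′) ≡ true → ⊥
  loud-clash {u} {B} 5≡ 5≡′ u∈ h k =
    not-D d≡5 clockwise (is5⇒≤ _ 5u′) (≤-reflexive 5≡) (le10⇒≤ _ (cong le10 (is10⇒≡ 10x₂))) (is5⇒≤ _ 5e) (≤-trans (le10⇒≤ _ (cong le10 (is10⇒≡ 10y₃))) (≤ᵇ⇒≤ 10 12 _))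
    where
    u′ = σ B u
    x₂ = σ u (σ u B)
    d = σ u x₂
    y₃ = σ u′ (σ u′ (σ u′ B))
    h₁ = ∧-elimʳ {is5 (κ (σ u B))} h
    h₂ = ∧-elimʳ {is10 (κ x₂)} h₁
    k₁ = ∧-elimʳ {is5 (κ (σ u′ y₃))} k
    k₂ = ∧-elimʳ {is10 (κ y₃)} k₁
    10x₂ : is10 (κ x₂) ≡ true
    10x₂ = ∧-elimˡ h₁
    10y₃ : is10 (κ y₃) ≡ true
    10y₃ = ∧-elimˡ k₁
    5d : is5 (κ d) ≡ true
    5d = ∧-elimˡ h₂
    d≡5 : deg d ≡ 5
    d≡5 = is5-deg 5d
    quiet : spoilt u ≡ 0 × mark u ≡ false
    quiet = unmarked-0 (spoilt u) (mark u) (∧-elimʳ {is5 (κ d)} h₂)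
    quiet′ : spoilt u′ ≡ 0 × mark u′ ≡ false
    quiet′ = unmarked-0 (spoilt u′) (mark u′) (∧-elimʳ {is5 (κ d)} k₂)
    s = proj₁ quiet
    s′ = proj₁ quiet′
    links = shared 5≡ u∈ (inj₁ s)
    5u′ : is5 (κ u′) ≡ true
    5u′ = cong (λ e → is5 (sizeOf e)) 5≡′
    x₂∈ : x₂ ∈ rot u
    x₂∈ = cycSucc-∈ (cycSucc-∈ (rot-sym u∈))
    B∈′ : B ∈ rot u′
    B∈′ = rot-sym (cycSucc-∈ u∈)
    y₂≡d : σ u′ (σ u′ B) ≡ d
    y₂≡d = trans (cong (σ u′) (proj₁ (proj₂ links))) (proj₂ (proj₂ links))
    y₃→u′ : σ d y₃ ≡ u′
    y₃→u′ = subst (λ z → σ z y₃ ≡ u′) y₂≡d (corner₂ s′ (cycSucc-∈ (cycSucc-∈ B∈′)))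
    u′→u : σ d u′ ≡ u
    u′→u = trans (cong (σ d) (sym (proj₁ links))) (corner₂ s (cycSucc-∈ x₂∈))
    u→x₂ : σ d u ≡ x₂
    u→x₂ = corner₁ s x₂∈
    y₃∈ : y₃ ∈ rot d
    y₃∈ = rot-sym (subst (_∈ rot y₃) y₂≡d y₂∈y₃)
      where
      y₂∈y₃ : σ u′ (σ u′ B) ∈ rot y₃
      y₂∈y₃ = subst (_∈ rot y₃) (corner₁ s′ (cycSucc-∈ (cycSucc-∈ B∈′))) (cycSucc-∈ (rot-sym (cycSucc-∈ (cycSucc-∈ (cycSucc-∈ B∈′)))))
    clockwise : CyclicListing (u′ ∷ u ∷ x₂ ∷ σ d x₂ ∷ y₃ ∷ []) (rot d)
    clockwise = subst (λ z → CyclicListing (z ∷ σ d z ∷ σ d (σ d z) ∷ σ d (σ d (σ d z)) ∷ y₃ ∷ []) (rot d)) y₃→u′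
        (Around.clockwise (five-around d≡5 y₃∈))
      |> λ l → subst (λ z → CyclicListing (u′ ∷ z ∷ σ d z ∷ σ d (σ d z) ∷ y₃ ∷ []) (rot d)) u′→u l
      |> λ l → subst (λ z → CyclicListing (u′ ∷ u ∷ z ∷ σ d z ∷ y₃ ∷ []) (rot d)) u→x₂ l
    5e : is5 (κ (σ d x₂)) ≡ true
    -- As `u` is unmarked, its neighbour `x₂` of degree 10 is not relieved, and the vertex after
    -- `x₂` around `d` is `beyond⁺ u x₂`.
    5e = conclude (any-false (relieved u) (rot u) x₂∈ (proj₂ quiet))
      where
      5x₄ : is5 (κ (σ u d)) ≡ true
      5x₄ = trans (cong (λ z → is5 (κ z)) (proj₁ links)) 5u′
      conclude : relieved u x₂ ≡ false → is5 (κ (σ d x₂)) ≡ true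
      conclude r rewrite 10x₂ | 5x₄ with is5 (κ (σ d x₂))
      ... | true = refl

  fits-next : ∀ {u B} → 10 ≤ deg B → u ∈ rot B → Fits (tileAt B u) (tileAt B (σ B u))
  fits-next {u} {B} 10≤ u∈ with bool-cases (is5 (κ u)) | bool-cases (is5 (κ (σ B u)))
  ... | inj₂ e | inj₂ e′ = subst₂ Fits (sym (tile-other {B} e)) (sym (tile-other {B} e′)) refl
  ... | inj₁ e | inj₂ e′ = subst₂ Fits (sym (tile-five 10≤ e)) (sym (tile-other {B} e′))
    (six-right (bigOf (deg B)) _ _ _ _ (corner u) (starless-at (is5-deg e) (rot-sym u∈)) (not-true λ h →
      let s = all-triangular-0 (spoilt u) (mark u) (∧-elimˡ h) in
      contradiction (trans (sym (∧-elimʳ {all-triangular? (corner u)} h))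
        (trans (cong (λ z → is5 (κ z)) (proj₁ (shared (is5-deg e) u∈ (inj₁ s)))) e′)) λ ()))
  ... | inj₂ e | inj₁ e′ = subst₂ Fits (sym (tile-other {B} e)) (sym (tile-five 10≤ e′))
    (six-left (bigOf (deg B)) _ _ _ _ (corner u′) (starless-at (is5-deg e′) B∈) (not-true λ h →
      contradiction (trans (sym (∧-elimʳ {all-triangular? (corner u′)} h))
        (trans (cong (λ z → is5 (κ z)) (before≡u (all-triangular-0 (spoilt u′) (mark u′) (∧-elimˡ h)))) e)) λ ()))
    where
    u′ = σ B u
    B∈ : B ∈ rot u′
    B∈ = rot-sym (cycSucc-∈ u∈)
    before≡u : spoilt u′ ≡ 0 → σ u′ B ≡ u
    before≡u s = cycSucc-injective (rot-unique B)
      (subst (σ u′ B ∈_) (cong rot (corner₁ s B∈)) (iter-dart 2 {B , u′} B∈)) u∈ (corner₂ s B∈)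
  ... | inj₁ e | inj₁ e′ = subst₂ Fits (sym (tile-five 10≤ e)) (sym (tile-five 10≤ e′)) (both (bool-cases (all-triangular? (corner u) ∨ all-triangular? (corner u′))))
    where
    u′ = σ B u
    b = bigOf (deg B)
    5≡ = is5-deg e
    5≡′ = is5-deg e′
    B∈ : B ∈ rot u′
    B∈ = rot-sym (cycSucc-∈ u∈)
    either : all-triangular? (corner u) ∨ all-triangular? (corner u′) ≡ true → spoilt u ≡ 0 ⊎ spoilt u′ ≡ 0
    either h with bool-cases (all-triangular? (corner u))
    ... | inj₁ t = inj₁ (all-triangular-0 (spoilt u) (mark u) t)
    ... | inj₂ t = inj₂ (all-triangular-0 (spoilt u′) (mark u′) (subst (λ z → z ∨ all-triangular? (corner u′) ≡ true) t h))
    neither : ∀ {p q} → p ∨ q ≡ false → not p ≡ true × not q ≡ true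
    neither {false} {false} _ = refl , refl
    both : all-triangular? (corner u) ∨ all-triangular? (corner u′) ≡ true ⊎ all-triangular? (corner u) ∨ all-triangular? (corner u′) ≡ false →
      Fits (tileFor B u) (tileFor B u′)
    both (inj₂ h) = loose-fits _ _
      (∧-elimʳ {loose (left (tileFor B u))} (loose-sides b _ _ _ _ (corner u) (proj₁ (neither h))))
      (∧-elimˡ (loose-sides b _ _ _ _ (corner u′) (proj₂ (neither {all-triangular? (corner u)} h))))
    -- By `shared`, the fourth entry of `u` is `u′`, the first entry of `u′` is `u`, and the second
    -- entry of `u′` is the third of `u`; this is the situation of `wheel`.
    both (inj₁ h) = subst₂ (λ s t → fits (right s) (left t) ≡ true) (sym tile₁) (sym tile₂)
      (wheel b x₁ x₂ x₃ (corner u) star₁ (corner u′) h y₃ y₄ star₂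
        (not-true λ l → loud-clash 5≡ 5≡′ u∈ (∧-elimˡ l) (∧-elimʳ {loud? x₁ x₂ x₃ five (corner u)} l))
        (not-true λ l → contradiction (trans (sym (∧-elimʳ {refund? b x₁ x₂ x₃ five (corner u)} l)) (quiet-right (∧-elimˡ l))) λ ())
        (not-true λ l → contradiction (trans (sym (∧-elimʳ {refund? b y₄ y₃ x₃ five (corner u′)} l)) (quiet-left (∧-elimˡ l))) λ ()))
      where
      x₁ = κ (σ u B)
      x₂ = κ (σ u (σ u B))
      x₃ = κ (σ u (σ u (σ u B)))
      y₃ = κ (σ u′ (σ u′ (σ u′ B)))
      y₄ = κ (σ u′ (σ u′ (σ u′ (σ u′ B))))
      links = shared 5≡ u∈ (either h)
      x₄≡ : κ (σ u (σ u (σ u (σ u B)))) ≡ five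
      x₄≡ = trans (cong κ (proj₁ links)) (is5⇒≡ e′)
      y₁≡ : κ (σ u′ B) ≡ five
      y₁≡ = trans (cong κ (proj₁ (proj₂ links))) (is5⇒≡ e)
      y₂≡ : κ (σ u′ (σ u′ B)) ≡ x₃
      y₂≡ = cong κ (trans (cong (σ u′) (proj₁ (proj₂ links))) (proj₂ (proj₂ links)))
      tile₁ : tileFor B u ≡ tileOf (rank b) x₁ x₂ x₃ five (corner u)
      tile₁ = cong (λ z → tileOf (rank b) x₁ x₂ x₃ z (corner u)) x₄≡
      tile₂ : tileFor B u′ ≡ tileOf (rank b) five x₃ y₃ y₄ (corner u′)
      tile₂ = cong₂ (λ z w → tileOf (rank b) z w y₃ y₄ (corner u′)) y₁≡ y₂≡
      star₁ : starless b x₁ x₂ x₃ five ≡ true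
      star₁ = subst (λ z → starless b x₁ x₂ x₃ z ≡ true) x₄≡ (starless-at 5≡ (rot-sym u∈))
      star₂ : starless b five x₃ y₃ y₄ ≡ true
      star₂ = subst₂ (λ z w → starless b z w y₃ y₄ ≡ true) y₁≡ y₂≡ (starless-at 5≡′ B∈)
      quiet-right : refund? b x₁ x₂ x₃ five (corner u) ≡ true → is5 y₄ ≡ false
      quiet-right r with refund⁻ 5≡ (rot-sym u∈) (subst (λ z → refund? b x₁ x₂ x₃ z (corner u) ≡ true) (sym x₄≡) r)
      ... | _ , f = subst (λ w → is5 (κ (σ w (σ w (σ w (σ w B))))) ≡ false) (proj₁ links) f
      quiet-left : refund? b y₄ y₃ x₃ five (corner u′) ≡ true → is5 x₁ ≡ false
      quiet-left r with refund⁺ 5≡′ B∈ (subst₂ (λ z w → refund? b y₄ y₃ w z (corner u′) ≡ true) (sym y₁≡) (sym y₂≡) r)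
      ... | _ , f = subst (λ w → is5 (κ (σ w B)) ≡ false) (proj₁ (proj₂ links)) f

  tile-available : ∀ {u B} → 10 ≤ deg B → u ∈ rot B → tileAt B u ∈ tiles (bigOf (deg B))
  tile-available {u} {B} 10≤ u∈ with bool-cases (is5 (κ u))
  ... | inj₁ e = subst (_∈ tiles (bigOf (deg B))) (sym (tile-five 10≤ e))
    (any-same⇒∈ _ _ (available (bigOf (deg B)) _ _ _ _ (corner u) (starless-at (is5-deg e) (rot-sym u∈))))
  ... | inj₂ e = subst (_∈ tiles (bigOf (deg B))) (sym (tile-other {B} e)) (six-available (bigOf (deg B)))

  given received : Fin n → ℕ
  given v = ∑ (rot v) (λ u → give v u)
  received v = ∑ (rot v) (λ u → give u v)

  big-can-pay : ∀ {B} → 10 ≤ deg B → 120 + given B ≤ 20 * deg B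
  big-can-pay {B} 10≤ = pay (rot B) refl
    where
    pay : ∀ xs → xs ≡ rot B → 120 + ∑ xs (give B) ≤ 20 * deg B
    pay [] e = ≤-trans (*-monoʳ-≤ 12 {10} 10≤) (*-monoˡ-≤ (deg B) {12} {20} (≤ᵇ⇒≤ 12 20 _))
    pay (x ∷ xs) e = subst (λ k → 120 + k ≤ 20 * deg B) (∑-map (tileAt B) (x ∷ xs) wt)
      (budget (deg B) 10≤ (tileAt B x) (map (tileAt B) xs)
        (tile-available 10≤ (subst (x ∈_) e (here refl)))
        (All.tabulate λ t∈ → let u , u∈ , t≡ = ∈-map⁻ (tileAt B) t∈ in
          subst (_∈ tiles (bigOf (deg B))) (sym t≡) (tile-available 10≤ (subst (u ∈_) e (there u∈))))
        -- The rotation is cut open at its first entry, whose tile begins and closes the chain.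
        (nextIn-chain (tileAt B) x x xs (subst Unique (sym e) (rot-unique B)) λ u u∈ →
          subst (λ ys → Fits (tileAt B u) (tileAt B (cycSucc ys u))) (sym e) (fits-next 10≤ (subst (u ∈_) e u∈)))
        (trans (length-map (tileAt B) (x ∷ xs)) (trans (cong length e) (length-rot B))))

  small-gives-nothing : ∀ {v} → (rankOf (deg v) ≡ five ⊎ rankOf (deg v) ≡ six) → given v ≡ 0
  small-gives-nothing {v} r = trans (∑-cong (rot v) λ u _ → nothing′ u r) (trans (∑-const (rot v) 0) (*-zeroʳ (length (rot v))))
    where
    nothing′ : ∀ u → rankOf (deg v) ≡ five ⊎ rankOf (deg v) ≡ six → give v u ≡ 0
    nothing′ u (inj₁ e) rewrite e with is5 (κ u)
    ... | true = refl
    ... | false = refl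
    nothing′ u (inj₂ e) rewrite e with is5 (κ u)
    ... | true = refl
    ... | false = refl

  big-or-le6 : ∀ s → big? s ≡ false → le6 s ≡ true
  big-or-le6 five _ = refl
  big-or-le6 six _ = refl

  five-is-paid : ∀ {u} → deg u ≡ 5 → 20 ≤ slack (corner u) + received u
  five-is-paid {u} 5≡ = subst (λ k → 20 ≤ slack (corner u) + k) (sym received≡)
    (≤ᵇ⇒≤ 20 _ (Equivalence.from T-≡ (five-paid (ρ a) (ρ b) (ρ c) (ρ d) (ρ e) some-big
      (∧-intro (pairs a∈ na nb nc nd) (∧-intro (pairs b∈ nb nc nd ne) (∧-intro (pairs c∈ nc nd ne na)
        (∧-intro (pairs d∈ nd ne na nb) (pairs e∈ ne na nb nc))))) (corner u))))
    where
    open Pentagon (pentagon (rot u) (rot-unique u) (trans (length-rot u) 5≡)) renaming (next-a to na; next-b to nb; next-c to nc; next-d to nd; next-e to ne)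
    ρ : Fin n → Rank
    ρ v = rankOf (deg v)
    5u : is5 (κ u) ≡ true
    5u = cong (λ k → is5 (sizeOf k)) 5≡
    a∈ : a ∈ rot u
    a∈ = subst (a ∈_) (sym shape) (here refl)
    b∈ : b ∈ rot u
    b∈ = subst (b ∈_) (sym shape) (there (here refl))
    c∈ : c ∈ rot u
    c∈ = subst (c ∈_) (sym shape) (there (there (here refl)))
    d∈ : d ∈ rot u
    d∈ = subst (d ∈_) (sym shape) (there (there (there (here refl))))
    e∈ : e ∈ rot u
    e∈ = subst (e ∈_) (sym shape) (there (there (there (there (here refl)))))
    listings : ∀ {w x₁ x₂ x₃ x₄} → w ∈ rot u → σ u w ≡ x₁ → σ u x₁ ≡ x₂ → σ u x₂ ≡ x₃ → σ u x₃ ≡ x₄ →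
      CyclicListing (x₁ ∷ x₂ ∷ x₃ ∷ x₄ ∷ w ∷ []) (rot u) × CyclicListing (x₄ ∷ x₃ ∷ x₂ ∷ x₁ ∷ w ∷ []) (rot u)
    listings w∈ refl refl refl refl = Around.clockwise (five-around 5≡ w∈) , Around.counterclockwise (five-around 5≡ w∈)
    pairs : ∀ {w x₁ x₂ x₃ x₄} → w ∈ rot u → σ u w ≡ x₁ → σ u x₁ ≡ x₂ → σ u x₂ ≡ x₃ → σ u x₃ ≡ x₄ →
      noLowPairs (ρ w) (ρ x₁) (ρ x₂) (ρ x₃) (ρ x₄) ≡ true
    pairs w∈ p q r s = ∧-intro (noLowPair-holds 5≡ (proj₁ (listings w∈ p q r s))) (noLowPair-holds 5≡ (proj₂ (listings w∈ p q r s)))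
    gift≡ : ∀ {w x₁ x₂ x₃ x₄} → σ u w ≡ x₁ → σ u x₁ ≡ x₂ → σ u x₂ ≡ x₃ → σ u x₃ ≡ x₄ →
      give w u ≡ gift (ρ w) (ρ x₁) (ρ x₂) (ρ x₃) (ρ x₄) (corner u)
    gift≡ {w} refl refl refl refl rewrite 5u = refl
    received≡ : received u ≡ gift (ρ a) (ρ b) (ρ c) (ρ d) (ρ e) (corner u) + (gift (ρ b) (ρ c) (ρ d) (ρ e) (ρ a) (corner u) +
      (gift (ρ c) (ρ d) (ρ e) (ρ a) (ρ b) (corner u) + (gift (ρ d) (ρ e) (ρ a) (ρ b) (ρ c) (corner u) +
      (gift (ρ e) (ρ a) (ρ b) (ρ c) (ρ d) (corner u) + 0))))
    received≡ = trans (cong (λ xs → ∑ xs (λ w → give w u)) shape)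
      (cong₂ _+_ (gift≡ na nb nc nd) (cong₂ _+_ (gift≡ nb nc nd ne) (cong₂ _+_ (gift≡ nc nd ne na)
        (cong₂ _+_ (gift≡ nd ne na nb) (cong₂ _+_ (gift≡ ne na nb nc) refl)))))
    small : ∀ {v} → big? (κ v) ≡ false → deg v ≤ 6
    small {v} h = le6⇒≤ (deg v) (big-or-le6 (κ v) h)
    none : ∀ {p q r s t} → p ∨ q ∨ r ∨ s ∨ t ≡ false → p ≡ false × q ≡ false × r ≡ false × s ≡ false × t ≡ false
    none {false} {false} {false} {false} {false} _ = refl , refl , refl , refl , refl
    some-big : big? (κ a) ∨ big? (κ b) ∨ big? (κ c) ∨ big? (κ d) ∨ big? (κ e) ≡ true
    some-big with bool-cases (big? (κ a) ∨ big? (κ b) ∨ big? (κ c) ∨ big? (κ d) ∨ big? (κ e))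
    ... | inj₁ h = h
    ... | inj₂ h with none {big? (κ a)} {big? (κ b)} {big? (κ c)} {big? (κ d)} {big? (κ e)} h
    -- Without a big neighbour all five degrees are at most 6, which is a star with bounds 6, 6, 6,
    -- 6, 11.
    ...   | fa , fb , fc , fd , fe = ⊥-elim (not-C 5≡ (proj₁ (listings e∈ ne na nb nc))
        (small fa) (small fb) (small fc) (small fd) (≤-trans (small fe) (≤ᵇ⇒≤ 6 11 _)))

  balance : ∀ v → 120 + given v ≤ 20 * deg v + 10 * spoilt v + received v
  balance v with degree-cases v
  ... | inj₁ 5≡ = begin
      120 + given v                                  ≡⟨ cong (120 +_) (small-gives-nothing (inj₁ (cong rankOf 5≡))) ⟩
      100 + 20                                       ≤⟨ +-monoʳ-≤ 100 (five-is-paid 5≡) ⟩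
      100 + (slack (corner v) + received v)          ≤⟨ +-monoʳ-≤ 100 (+-monoˡ-≤ (received v) (slack-cornersOf (spoilt v) (mark v))) ⟩
      100 + (10 * spoilt v + received v)             ≡⟨ +-assoc 100 (10 * spoilt v) (received v) ⟨
      100 + 10 * spoilt v + received v               ≡⟨ cong (λ k → 20 * k + 10 * spoilt v + received v) 5≡ ⟨
      20 * deg v + 10 * spoilt v + received v        ∎
    where open ≤-Reasoning
  ... | inj₂ (inj₁ 6≡) = begin
      120 + given v                                  ≡⟨ cong (120 +_) (small-gives-nothing (inj₂ (cong rankOf 6≡))) ⟩
      120                                            ≡⟨ cong (20 *_) 6≡ ⟨
      20 * deg v                                     ≤⟨ ≤-trans (m≤m+n (20 * deg v) (10 * spoilt v)) (m≤m+n _ (received v)) ⟩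
      20 * deg v + 10 * spoilt v + received v        ∎
    where open ≤-Reasoning
  ... | inj₂ (inj₂ 10≤) = ≤-trans (big-can-pay 10≤) (≤-trans (m≤m+n (20 * deg v) (10 * spoilt v)) (m≤m+n _ (received v)))

  impossible : ⊥
  impossible = n≮n (120 * n + ∑ V given) (begin-strict
      120 * n + ∑ V given                                        ≡⟨ cong (_+ ∑ V given) (sym (trans (∑-const V 120) (trans (cong (_* 120) (length-tabulate (λ (i : Fin n) → i))) (*-comm n 120)))) ⟩
      ∑ V (λ _ → 120) + ∑ V given                                ≡⟨ ∑-+ V (λ _ → 120) given ⟨
      ∑ V (λ v → 120 + given v)                                  ≤⟨ ∑-mono V (λ v _ → balance v) ⟩
      ∑ V (λ v → 20 * deg v + 10 * spoilt v + received v)        ≡⟨ ∑-+ V (λ v → 20 * deg v + 10 * spoilt v) received ⟩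
      ∑ V (λ v → 20 * deg v + 10 * spoilt v) + ∑ V received      ≡⟨ cong₂ _+_ (trans (∑-+ V (λ v → 20 * deg v) (λ v → 10 * spoilt v)) (cong₂ _+_ (∑-* V 20 deg) (∑-* V 10 spoilt))) (sym given≡received) ⟩
      20 * ∑ V deg + 10 * ∑ V spoilt + ∑ V given                 <⟨ +-monoˡ-< (∑ V given) (euler′ (∑ V deg) (∑ V spoilt) euler-bound) ⟩
      120 * n + ∑ V given                                        ∎)
    where
    open ≤-Reasoning
    V = allFin n
    euler′ : ∀ D E → 2 * D + E + 24 ≤ 12 * n → 20 * D + 10 * E < 120 * n
    euler′ D E h = begin-strict
      -- Strictness comes from 240 = 10 · 24, the contribution of at least one component in Euler's
      -- formula.
      20 * D + 10 * E               <⟨ m<m+n _ {240} (s≤s z≤n) ⟩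
      20 * D + 10 * E + 240         ≡⟨ solve 2 (λ D E → con 20 :* D :+ con 10 :* E :+ con 240 := con 10 :* (con 2 :* D :+ E :+ con 24)) refl D E ⟩
      10 * (2 * D + E + 24)         ≤⟨ *-monoʳ-≤ 10 h ⟩
      10 * (12 * n)                 ≡⟨ *-assoc 10 12 n ⟨
      120 * n                       ∎
      where open +-*-Solver
    given≡received : ∑ V given ≡ ∑ V received
    given≡received = trans (∑-cong V (λ v _ → ∑-↭ _ (rotNbrs v))) (trans (exchange give) (sym (∑-cong V (λ v _ → ∑-↭ _ (rotNbrs v)))))

-- Decidability of stars

rotation? : ∀ {A : Set} {P : List A → Set} → (∀ xs → Dec (P xs)) → ∀ xs → Dec (∃ λ k → P (rotateL k xs))
rotation? {P = P} P? xs = map′ (λ (k , p) → toℕ k , p) to (any? {n = suc (length xs)} λ k → P? (rotateL (toℕ k) xs))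
  where
  to : (∃ λ k → P (rotateL k xs)) → ∃ λ (k : Fin (suc (length xs))) → P (rotateL (toℕ k) xs)
  to (k , p) with k <? suc (length xs)
  ... | yes k< = fromℕ< k< , subst (λ j → P (rotateL j xs)) (sym (toℕ-fromℕ< k<)) p
  -- Rotating by the length or more returns the list itself, which the index 0 already represents.
  ... | no k≮ = zero , subst P (trans (cong₂ _++_ (drop-all k xs l≤k) (take-all k xs l≤k)) (sym (++-identityʳ xs))) p
    where l≤k = ≤-trans (n≤1+n _) (≮⇒≥ k≮)

module _ {n : ℕ} (G : PlaneGraph n) where
  open PlaneGraph G using (deg; rot)

  Bounded : ∀ {m} → Vec (Maybe ℕ) m → List (Fin n) → Set
  Bounded κ xs = Σ (Vec (Fin n) _) λ ws → toList ws ≡ xs × (∀ i → deg (Vec.lookup ws i) ≤κ Vec.lookup κ i)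

  ≤κ? : ∀ d k → Dec (d ≤κ k)
  ≤κ? d nothing = yes tt
  ≤κ? d (just k) = d ≤? k

  bounded? : ∀ {m} (κ : Vec (Maybe ℕ) m) xs → Dec (Bounded κ xs)
  bounded? [] [] = yes ([] , refl , λ ())
  bounded? [] (x ∷ xs) = no λ { ([] , () , _) }
  bounded? (k ∷ κ) [] = no λ { (_ ∷ _ , () , _) }
  bounded? (k ∷ κ) (x ∷ xs) = map′
    (λ { (p , ws , refl , q) → x ∷ ws , refl , λ { zero → p ; (suc i) → q i } })
    (λ { (w ∷ ws , refl , q) → q zero , ws , refl , λ i → q (suc i) })
    (≤κ? (deg x) k ×-dec bounded? κ xs)

  -- Discharging only refutes the simultaneous absence of the four stars; deciding each of them
  -- yields the disjunction constructively.
  hasStar? : ∀ κ → Dec (HasStar G κ)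
  hasStar? κ = map′ to from (any? λ v → (deg v ℕ.≟ 5) ×-dec
      (rotation? (bounded? κ) (rot v) ⊎-dec rotation? (bounded? κ) (reverse (rot v))))
    where
    to : (∃ λ v → deg v ≡ 5 × ((∃ λ k → Bounded κ (rotateL k (rot v))) ⊎ (∃ λ k → Bounded κ (rotateL k (reverse (rot v)))))) → HasStar G κ
    to (v , d , inj₁ (k , ws , e , h)) = v , ws , d , (k , inj₁ e) , h
    to (v , d , inj₂ (k , ws , e , h)) = v , ws , d , (k , inj₂ e) , h
    from : HasStar G κ → ∃ λ v → deg v ≡ 5 × ((∃ λ k → Bounded κ (rotateL k (rot v))) ⊎ (∃ λ k → Bounded κ (rotateL k (reverse (rot v)))))
    from (v , ws , d , (k , inj₁ e) , h) = v , d , inj₁ (k , ws , e , h)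
    from (v , ws , d , (k , inj₂ e) , h) = v , d , inj₂ (k , ws , e , h)

theorem9 : (n : ℕ) → 0 < n → (G : PlaneGraph n) →
    (∀ v → 5 ≤ PlaneGraph.deg G v) →
    (∀ v → PlaneGraph.deg G v ≢ 7) →
    (∀ v → PlaneGraph.deg G v ≢ 8) →
    (∀ v → PlaneGraph.deg G v ≢ 9) →
    HasStar G (just 5 ∷ just 6 ∷ just 6 ∷ just 5 ∷ nothing ∷ [])
    ⊎ HasStar G (just 5 ∷ just 6 ∷ just 6 ∷ just 6 ∷ just 17 ∷ [])
    ⊎ HasStar G (just 6 ∷ just 6 ∷ just 6 ∷ just 6 ∷ just 11 ∷ [])
    ⊎ HasStar G (just 5 ∷ just 5 ∷ just 10 ∷ just 5 ∷ just 12 ∷ [])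
theorem9 n 0<n G mindeg no7 no8 no9
  with hasStar? G (just 5 ∷ just 6 ∷ just 6 ∷ just 5 ∷ nothing ∷ [])
     | hasStar? G (just 5 ∷ just 6 ∷ just 6 ∷ just 6 ∷ just 17 ∷ [])
     | hasStar? G (just 6 ∷ just 6 ∷ just 6 ∷ just 6 ∷ just 11 ∷ [])
     | hasStar? G (just 5 ∷ just 5 ∷ just 10 ∷ just 5 ∷ just 12 ∷ [])
... | yes A | _ | _ | _ = inj₁ A
... | no _ | yes B | _ | _ = inj₂ (inj₁ B)
... | no _ | no _ | yes C | _ = inj₂ (inj₂ (inj₁ C))
... | no _ | no _ | no _ | yes D = inj₂ (inj₂ (inj₂ D))
... | no noA | no noB | no noC | no noD =
  ⊥-elim (Discharge.impossible 0<n G mindeg no7 no8 no9 noA noB noC noD)
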